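{- Let $d\ge1$, $n\ge d+2$, and let $T$ be a $d$-hypertree in $K_n^d$. Then the facet graph $G_d(T)$ is $d$-connected.
   Context: Fix a field $\mathbb F$. A $d$-simplex is a $(d+1)$-element subset of $[n]$ oriented by increasing order; $K_n^d$ is the complex of all subsets of $[n]$ of size at most $d+1$. A $d$-chain is a formal $\mathbb F$-combination of $d$-simplices with boundary $\partial\{s_1<\dots<s_{d+1}\}=\sum_i(-1)^{i-1}(\sigma\setminus\{s_i\})$ extended linearly; a $d$-cycle is a chain with $\partial Z=0$. A set of $d$-simplices is acyclic if it supports no nonzero $d$-cycle; a $d$-hypertree is a maximal acyclic set of $d$-simplices of $K_n^d$. The facet graph $G_d(T)$ has vertex set $T$, two $d$-simplices adjacent iff they share a $(d-1)$-face. A graph is $k$-connected if deleting any set of fewer than $k$ of its vertices leaves a nonempty connected graph. -}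

module Defs where

open import Level using (Level; 0ℓ; _⊔_) renaming (suc to lsuc)
open import Algebra.Bundles using (CommutativeRing)
open import Algebra.Definitions using (Invertible)
import Algebra.Properties.Semiring.Exp as Exp
import Algebra.Properties.Semiring.Sum as Sum
open import Data.Bool.Base using (Bool; true; if_then_else_; _∧_)
import Data.Bool.Properties as Bool
open import Data.Fin.Base using (Fin)
open import Data.Fin.Properties using (_<?_)
open import Data.Fin.Subset using (Subset; inside; outside; ∣_∣; _∩_; _-_; _⊆_)
open import Data.Fin.Subset.Properties using (_∈?_)
open import Data.List.Base using (List; []; _∷_; [_]; _++_; map; foldr; length)
open import Data.List.Membership.Propositional using () renaming (_∉_ to _∉ˡ_)
open import Data.List.Relation.Unary.Unique.Propositional using (Unique)
open import Data.Nat.Base using (ℕ; zero; suc; _<_)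
open import Data.Product.Base using (∃; _×_)
open import Data.Refinement.Base using (Refinement; value)
open import Data.Vec.Base using ([]; _∷_; tabulate)
open import Data.Vec.Properties using (≡-dec)
open import Relation.Binary.Core using (Rel)
open import Relation.Binary.Construct.Closure.ReflexiveTransitive using (Star)
open import Relation.Binary.PropositionalEquality using (_≡_; _≢_; refl; cong)
open import Relation.Nullary.Decidable.Core using (does)
open import Relation.Nullary.Negation.Core using (¬_)

-- The textbook definition; no decidability of _≈_ is assumed.
record Field (c ℓ : Level) : Set (lsuc (c ⊔ ℓ)) where
  field
    commutativeRing : CommutativeRing c ℓ
  open CommutativeRing commutativeRing public
  field
    0≉1        : ¬ (0# ≈ 1#)
    invertible : ∀ x → ¬ (x ≈ 0#) → Invertible _≈_ 1# _*_ x

-- Indexed by cardinality, not dimension: the d-simplices on n vertices are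
-- Face n (suc d), and their (d-1)-faces are Face n d.  The cardinality proof
-- is irrelevant, so faces with equal vertex sets are equal.
record Face (n k : ℕ) : Set where
  constructor mkFace
  field
    vertices : Subset n
    .card    : ∣ vertices ∣ ≡ k
open Face public

addInside : ∀ {n k} → Face n k → Face (suc n) (suc k)
addInside (mkFace p e) = mkFace (inside ∷ p) (cong suc e)

addOutside : ∀ {n k} → Face n k → Face (suc n) k
addOutside (mkFace p e) = mkFace (outside ∷ p) e

-- Every k-element subset of Fin n, listed exactly once.
faces : ∀ n k → List (Face n k)
faces zero    zero    = [ mkFace [] refl ]
faces zero    (suc k) = []
faces (suc n) zero    = map addOutside (faces n zero)
faces (suc n) (suc k) = map addInside (faces n k) ++ map addOutside (faces n (suc k))

-- The number of elements of p below v; for v = sᵢ in {s₁ < … < sₖ} this is i - 1.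
rank : ∀ {n} → Subset n → Fin n → ℕ
rank p v = ∣ p ∩ tabulate (λ u → does (u <? v)) ∣

-- All d-simplices on n vertices lie in K_n^d, so a set of d-simplices of K_n^d
-- is a characteristic function on all of Face n (suc d).
SimplexSet : ℕ → ℕ → Set
SimplexSet n d = Face n (suc d) → Bool

infix 4 _∈ˢ_ _⊆ˢ_

_∈ˢ_ : ∀ {n d} → Face n (suc d) → SimplexSet n d → Set
σ ∈ˢ T = T σ ≡ true

_⊆ˢ_ : ∀ {n d} → SimplexSet n d → SimplexSet n d → Set
T ⊆ˢ U = ∀ σ → σ ∈ˢ T → σ ∈ˢ U

module Chains {c ℓ} (F : Field c ℓ) where
  open Field F hiding (_-_)
  open Exp semiring using (_^_)
  open Sum semiring using (sum-syntax)

  Chain : ℕ → ℕ → Set c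
  Chain n k = Face n k → Carrier

  -- ∑ over v ∈ σ of (-1)^(rank of v in σ) · (σ ∖ {v}), as a coefficient function.
  ∂-simplex : ∀ {n k} → Face n (suc k) → Chain n k
  ∂-simplex {n} σ τ = ∑[ v < n ]
    (if does (v ∈? vertices σ) ∧ does (≡-dec Bool._≟_ (vertices σ - v) (vertices τ))
     then (- 1#) ^ rank (vertices σ) v
     else 0#)

  ∂ : ∀ {n k} → Chain n (suc k) → Chain n k
  ∂ {n} {k} Z τ = foldr (λ σ s → Z σ * ∂-simplex σ τ + s) 0# (faces n (suc k))

  IsZero : ∀ {n k} → Chain n k → Set ℓ
  IsZero Z = ∀ σ → Z σ ≈ 0#

  IsCycle : ∀ {n k} → Chain n (suc k) → Set ℓ
  IsCycle Z = IsZero (∂ Z)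

  SupportedOn : ∀ {n d} → SimplexSet n d → Chain n (suc d) → Set ℓ
  SupportedOn T Z = ∀ σ → ¬ (σ ∈ˢ T) → Z σ ≈ 0#

  Acyclic : ∀ {n d} → SimplexSet n d → Set (c ⊔ ℓ)
  Acyclic T = ¬ ∃ λ Z → IsCycle Z × SupportedOn T Z × ¬ IsZero Z

  record IsHypertree {n d} (T : SimplexSet n d) : Set (c ⊔ ℓ) where
    field
      acyclic : Acyclic T
      maximal : ∀ U → T ⊆ˢ U → Acyclic U → U ⊆ˢ T

open Chains public using (IsHypertree)

record Graph : Set₁ where
  field
    Vertex : Set
    Adj    : Rel Vertex 0ℓ

-- The induced subgraph on the complement of S.
delete : (G : Graph) → List (Graph.Vertex G) → Graph
delete G S = record
  { Vertex = Refinement (Graph.Vertex G) (λ v → v ∉ˡ S)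
  ; Adj    = λ u v → Graph.Adj G (value u) (value v)
  }

NonemptyConnected : Graph → Set
NonemptyConnected G = Graph.Vertex G × (∀ u v → Star (Graph.Adj G) u v)

-- A finite vertex set is given as a repetition-free list, whose length is its size.
KConnected : ℕ → Graph → Set
KConnected k G = (S : List (Graph.Vertex G)) → Unique S → length S < k →
                 NonemptyConnected (delete G S)

facetGraph : ∀ {n d} → SimplexSet n d → Graph
facetGraph {n} {d} T = record
  { Vertex = Refinement (Face n (suc d)) (λ σ → σ ∈ˢ T)
  ; Adj    = λ σ τ → value σ ≢ value τ ×
      (∃ λ (ρ : Face n d) → vertices ρ ⊆ vertices (value σ) × vertices ρ ⊆ vertices (value τ))
  }

{-# OPTIONS --safe #-}
module Submission where

-- Suppose deleting S, with |S| < d, splits T into A ∋ α and B ∋ β sharing no (d-1)-face.  Pair the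
-- vertices of α ∖ β with those of β ∖ α as (aᵢ , bᵢ).  Let w be a combination of the d facets of α
-- through a fixed vertex.  Exchanging each aᵢ for bᵢ turns w into a chain w′ on β, and w - w′ is
-- homologous to a chain of degenerate faces, those containing some pair {aᵢ , bᵢ}.  So some T-chain t
-- has boundary w′ - w up to degenerate faces, and since there are d coefficients and |S| < d
-- conditions, a nonzero w can be chosen for which t vanishes on S.  Then t = tᴬ + tᴮ, and ∂ tᴬ + w
-- is degenerate.  The retraction bᵢ ↦ aᵢ commutes with ∂, kills degenerate faces and fixes w,
-- hence ∂ w = 0.  But w is a cone, so w = 0.
--
-- Scalars are not decidable, so the linear algebra is done under double negation; this suffices
-- because the conclusion concerns a finite graph, whose reachability relation is decidable.

open import Defs
import Algebra.Properties.AbelianGroup as AbelianGroupProperties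
import Algebra.Properties.CommutativeSemigroup as CommutativeSemigroupProperties
import Algebra.Properties.Ring as RingProperties
import Algebra.Properties.Semiring.Exp as Exp
import Algebra.Properties.Semiring.Sum as Sum
open import Data.Bool.Base using (true; false; if_then_else_; _∧_; _∨_)
import Data.Bool.Properties as Bool
open import Data.Empty using (⊥; ⊥-elim; ⊥-elim-irr)
open import Data.Fin.Base using (Fin; zero; suc; punchIn)
open import Data.Fin.Properties using (_≟_; _<?_; any?; punchInᵢ≢i; suc-injective)
open import Data.Fin.Subset using (Subset; inside; outside; ∣_∣; _∩_; ∁; _-_; _⊆_)
open import Data.Fin.Subset.Properties using (_∈?_; _⊆?_; anySubset?; p─⊥≡p)
open import Data.Irrelevant using ([_])
open import Data.List.Base using (List; []; _∷_; _++_; map; foldr; length)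
import Data.List.Membership.DecPropositional as DecMembership
open import Data.List.Membership.Propositional using (_∈_; _∉_)
open import Data.List.Membership.Propositional.Properties using (∈-map⁺; ∈-map⁻; ∈-++⁺ˡ; ∈-++⁺ʳ)
open import Data.List.Properties using (length-map)
open import Data.List.Relation.Unary.All as All using (All; []; _∷_)
open import Data.List.Relation.Unary.Any using (here; there)
open import Data.Nat.Base as ℕ using (ℕ; zero; suc; _<_; _≤_; z≤n; s≤s)
import Data.Nat.Properties as ℕ
open import Data.Product.Base using (Σ; ∃; _×_; _,_; proj₁; proj₂)
open import Data.Refinement.Base using (value; _,_)
open import Data.Sum.Base using (_⊎_; inj₁; inj₂; [_,_]′)
open import Data.Vec.Base using ([]; _∷_; lookup; tabulate; _[_]≔_)
open import Data.Vec.Functional using (insertAt)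
open import Data.Vec.Functional.Properties using (insertAt-lookup; insertAt-punchIn)
open import Data.Vec.Properties using (≡-dec; lookup∘update; lookup∘update′; []≔-idempotent; []≔-lookup; []=⇒lookup; lookup⇒[]=)
open import Function.Base using (_∘_; id)
open import Level using (_⊔_)
open import Relation.Binary.Construct.Closure.ReflexiveTransitive as Star using (Star)
open import Relation.Binary.Definitions using (Decidable; DecidableEquality)
open import Relation.Binary.PropositionalEquality.Core as ≡ using (_≡_; _≢_; refl)
open import Relation.Nullary.Decidable using (Dec; yes; no; does; map′; ¬?; _×-dec_; _⊎-dec_; dec-true; toSum; decidable-stable; recompute)
open import Relation.Nullary.Negation using (¬_; contradiction; contradiction-irr)

private variable
  n m k : ℕ

-- Finite subsets: enumerations, cardinalities, and the pairing of two differences.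

record Enumeration (p : Subset n) (k : ℕ) : Set where
  field
    element    : Fin k → Fin n
    injective  : ∀ {i j} → element i ≡ element j → i ≡ j
    sound      : ∀ i → lookup p (element i) ≡ inside
    complete   : ∀ v → lookup p v ≡ inside → ∃ λ i → element i ≡ v
open Enumeration public

enumerate : (p : Subset n) → Enumeration p ∣ p ∣
enumerate [] = record { element = λ () ; injective = λ {} ; sound = λ () ; complete = λ () }
enumerate (outside ∷ p) = record
  { element   = suc ∘ e .element
  ; injective = e .injective ∘ suc-injective
  ; sound     = e .sound
  ; complete  = λ { (suc v) v∈p → let i , eq = e .complete v v∈p in i , ≡.cong suc eq }
  } where e = enumerate p
enumerate {suc n} (inside ∷ p) = record
  { element   = el
  ; injective = λ { {zero} {zero} _ → refl ; {suc i} {suc j} eq → ≡.cong suc (e .injective (suc-injective eq)) }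
  ; sound     = λ { zero → refl ; (suc i) → e .sound i }
  ; complete  = λ { zero _ → zero , refl
                  ; (suc v) v∈p → let i , eq = e .complete v v∈p in suc i , ≡.cong suc eq }
  } where
  e = enumerate p
  el : Fin (suc ∣ p ∣) → Fin (suc n)
  el zero    = zero
  el (suc i) = suc (e .element i)

∣insert∣ : (p : Subset n) (v : Fin n) → lookup p v ≡ outside → ∣ p [ v ]≔ inside ∣ ≡ suc ∣ p ∣
∣insert∣ (outside ∷ p) zero    eq = refl
∣insert∣ (inside  ∷ p) (suc v) eq = ≡.cong suc (∣insert∣ p v eq)
∣insert∣ (outside ∷ p) (suc v) eq = ∣insert∣ p v eq

-- Both sides count the union of `p` and `q`. For sets of equal size, cancellation shows that the
-- two differences can be paired off.
∣p∩∁q∣+∣q∣≡∣q∩∁p∣+∣p∣ : (p q : Subset n) → ∣ p ∩ ∁ q ∣ ℕ.+ ∣ q ∣ ≡ ∣ q ∩ ∁ p ∣ ℕ.+ ∣ p ∣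
∣p∩∁q∣+∣q∣≡∣q∩∁p∣+∣p∣ []            []            = refl
∣p∩∁q∣+∣q∣≡∣q∩∁p∣+∣p∣ (inside  ∷ p) (inside  ∷ q) =
  ≡.trans (ℕ.+-suc _ _) (≡.trans (≡.cong suc (∣p∩∁q∣+∣q∣≡∣q∩∁p∣+∣p∣ p q)) (≡.sym (ℕ.+-suc _ _)))
∣p∩∁q∣+∣q∣≡∣q∩∁p∣+∣p∣ (inside  ∷ p) (outside ∷ q) =
  ≡.trans (≡.cong suc (∣p∩∁q∣+∣q∣≡∣q∩∁p∣+∣p∣ p q)) (≡.sym (ℕ.+-suc _ _))
∣p∩∁q∣+∣q∣≡∣q∩∁p∣+∣p∣ (outside ∷ p) (inside  ∷ q) =
  ≡.trans (ℕ.+-suc _ _) (≡.cong suc (∣p∩∁q∣+∣q∣≡∣q∩∁p∣+∣p∣ p q))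
∣p∩∁q∣+∣q∣≡∣q∩∁p∣+∣p∣ (outside ∷ p) (outside ∷ q) = ∣p∩∁q∣+∣q∣≡∣q∩∁p∣+∣p∣ p q

∈-∩∁⁻ : (p q : Subset n) (v : Fin n) → lookup (p ∩ ∁ q) v ≡ inside →
        lookup p v ≡ inside × lookup q v ≡ outside
∈-∩∁⁻ (inside ∷ p) (outside ∷ q) zero    eq = refl , refl
∈-∩∁⁻ (_      ∷ p) (_       ∷ q) (suc v) eq = ∈-∩∁⁻ p q v eq

∈-∩∁⁺ : (p q : Subset n) (v : Fin n) → lookup p v ≡ inside → lookup q v ≡ outside →
        lookup (p ∩ ∁ q) v ≡ inside
∈-∩∁⁺ (inside ∷ p) (outside ∷ q) zero    _   _   = refl
∈-∩∁⁺ (_      ∷ p) (_       ∷ q) (suc v) v∈p v∉q = ∈-∩∁⁺ p q v v∈p v∉q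

infix 4 _⊑_
_⊑_ : Subset n → Subset n → Set
p ⊑ q = ∀ v → lookup p v ≡ inside → lookup q v ≡ inside

⊑-insert : ∀ w (p : Subset n) → p ⊑ p [ w ]≔ inside
⊑-insert w p v v∈p with v ≟ w
... | yes refl = lookup∘update v p inside
... | no v≢w   = ≡.trans (lookup∘update′ v≢w p inside) v∈p

-- The pairing is the shared index: the `i`-th vertex of `α ∖ β` goes with the `i`-th vertex of
-- `β ∖ α`.
record Matching (α β : Subset n) : Set where
  field
    size  : ℕ
    from  : Enumeration (α ∩ ∁ β) size
    to    : Enumeration (β ∩ ∁ α) size

matching : (α β : Subset n) → ∣ α ∣ ≡ ∣ β ∣ → Matching α β
matching α β eq = record
  { size = _
  ; from = enumerate (α ∩ ∁ β)
  ; to   = ≡.subst (Enumeration (β ∩ ∁ α)) (≡.sym ∣α∩∁β∣≡∣β∩∁α∣) (enumerate (β ∩ ∁ α))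
  } where
  ∣α∩∁β∣≡∣β∩∁α∣ : ∣ α ∩ ∁ β ∣ ≡ ∣ β ∩ ∁ α ∣
  ∣α∩∁β∣≡∣β∩∁α∣ = ℕ.+-cancelʳ-≡ _ _ _
    (≡.trans (∣p∩∁q∣+∣q∣≡∣q∩∁p∣+∣p∣ α β) (≡.cong (∣ β ∩ ∁ α ∣ ℕ.+_) eq))

subset-of-size : k ≤ n → ∃ λ (p : Subset n) → ∣ p ∣ ≡ k
subset-of-size {n = zero}  z≤n       = [] , refl
subset-of-size {n = suc n} z≤n       = let p , eq = subset-of-size z≤n in outside ∷ p , eq
subset-of-size {n = suc n} (s≤s k≤n) = let p , eq = subset-of-size k≤n in inside ∷ p , ≡.cong suc eq

subsets : ∀ n → List (Subset n)
subsets zero    = [] ∷ []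
subsets (suc n) = map (inside ∷_) (subsets n) ++ map (outside ∷_) (subsets n)

∈-subsets : (p : Subset n) → p ∈ subsets n
∈-subsets []            = here refl
∈-subsets (inside  ∷ p) = ∈-++⁺ˡ (∈-map⁺ (inside ∷_) (∈-subsets p))
∈-subsets (outside ∷ p) = ∈-++⁺ʳ (map (inside ∷_) (subsets _)) (∈-map⁺ (outside ∷_) (∈-subsets p))

-- Decidable reachability in a finite graph.

module Reachability {A : Set} (_≟ᴬ_ : DecidableEquality A) {E : A → A → Set} (E? : Decidable E) where

  -- As in the Floyd–Warshall algorithm, the list holds the admissible intermediate vertices.
  Path : List A → A → A → Set
  Path []      u v = u ≡ v ⊎ E u v
  Path (x ∷ L) u v = Path L u v ⊎ (Path L u x × Path L x v)

  path? : ∀ L → Decidable (Path L)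
  path? []      u v = (u ≟ᴬ v) ⊎-dec E? u v
  path? (x ∷ L) u v = path? L u v ⊎-dec (path? L u x ×-dec path? L x v)

  path-refl : ∀ L {u} → Path L u u
  path-refl []      = inj₁ refl
  path-refl (x ∷ L) = inj₁ (path-refl L)

  path-edge : ∀ L {u v} → E u v → Path L u v
  path-edge []      e = inj₂ e
  path-edge (x ∷ L) e = inj₁ (path-edge L e)

  -- Induction on the position of `x`. If `x` is the head, each half is cut at its visit to `x`. If
  -- both halves pass through another head, the detour from that head to `x` and back is dropped.
  path-trans : ∀ {L u x v} → x ∈ L → Path L u x → Path L x v → Path L u v
  path-trans (here refl) p q = inj₂ ([ (λ p → p) , proj₁ ]′ p , [ (λ q → q) , proj₂ ]′ q)
  path-trans (there x∈L) (inj₁ p)        (inj₁ q)        = inj₁ (path-trans x∈L p q)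
  path-trans (there x∈L) (inj₁ p)        (inj₂ (q , q′)) = inj₂ (path-trans x∈L p q , q′)
  path-trans (there x∈L) (inj₂ (p , p′)) (inj₁ q)        = inj₂ (p , path-trans x∈L p′ q)
  path-trans (there x∈L) (inj₂ (p , p′)) (inj₂ (q , q′)) = inj₂ (p , q′)

  path⇒star : ∀ L {u v} → Path L u v → Star E u v
  path⇒star []      (inj₁ refl)    = Star.ε
  path⇒star []      (inj₂ e)       = e Star.◅ Star.ε
  path⇒star (x ∷ L) (inj₁ p)       = path⇒star L p
  path⇒star (x ∷ L) (inj₂ (p , q)) = path⇒star L p Star.◅◅ path⇒star L q

-- Chains as an exterior algebra: wedge, contraction and boundary.

module ExteriorAlgebra {c ℓ} (F : Field c ℓ) where
  open Field F hiding (zero; _-_) renaming (refl to ≈-refl; sym to ≈-sym; trans to ≈-trans) public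
  open AbelianGroupProperties +-abelianGroup using (⁻¹-∙-comm; ⁻¹-involutive; ε⁻¹≈ε; inverseˡ-unique; xyx⁻¹≈y) public
  open CommutativeSemigroupProperties +-commutativeSemigroup using (interchange; x∙yz≈y∙xz) public
  open RingProperties ring using (-‿distribˡ-*; -‿distribʳ-*; -1*x≈-x) public
  open Sum semiring using (sum; sum-cong-≋; sum-replicate-zero; ∑-distrib-+; *-distribˡ-sum; *-distribʳ-sum; sum-remove) public
  open import Relation.Binary.Reasoning.Setoid setoid public

  -- Chains of all dimensions at once: ∂ Z at p only involves values of Z in cardinality ∣ p ∣ + 1,
  -- so nothing is lost, and operators can be defined by recursion on the ground set.
  C : ℕ → Set c
  C n = Subset n → Carrier

  infix 4 _≋_
  _≋_ : C n → C n → Set ℓ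
  Z ≋ W = ∀ p → Z p ≈ W p

  0ᶜ : C n
  0ᶜ p = 0#

  infixl 6 _⊕_
  _⊕_ : C n → C n → C n
  (Z ⊕ W) p = Z p + W p

  infix 8 ⊖_
  ⊖_ : C n → C n
  (⊖ Z) p = - Z p

  infixr 7 _·_
  _·_ : Carrier → C n → C n
  (a · Z) p = a * Z p

  -- ε v is Z ↦ v ∧ Z and ι v is contraction by v; passing the vertex 0 of a face costs a sign.
  ε : Fin n → C n → C n
  ε zero    Z (inside  ∷ p) = Z (outside ∷ p)
  ε zero    Z (outside ∷ p) = 0#
  ε (suc v) Z (inside  ∷ p) = - ε v (Z ∘ (inside ∷_)) p
  ε (suc v) Z (outside ∷ p) = ε v (Z ∘ (outside ∷_)) p

  ι : Fin n → C n → C n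
  ι zero    Z (inside  ∷ p) = 0#
  ι zero    Z (outside ∷ p) = Z (inside ∷ p)
  ι (suc v) Z (inside  ∷ p) = - ι v (Z ∘ (inside ∷_)) p
  ι (suc v) Z (outside ∷ p) = ι v (Z ∘ (outside ∷_)) p

  -- The augmented simplicial boundary, read at `p` as a signed sum over the cofaces of `p`: adding
  -- the vertex 0 has sign plus, and adding a later vertex costs a sign when 0 is in `p`. It is the
  -- sum of the contractions `ι v` over all `v`.
  ∂ : C n → C n
  ∂ Z []            = 0#
  ∂ Z (inside  ∷ p) = - ∂ (Z ∘ (inside ∷_)) p
  ∂ Z (outside ∷ p) = Z (inside ∷ p) + ∂ (Z ∘ (outside ∷_)) p

  +-elimʳ : ∀ {x y} → y ≈ 0# → x + y ≈ x
  +-elimʳ y≈0 = ≈-trans (+-congˡ y≈0) (+-identityʳ _)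

  +-elimˡ : ∀ {x y} → x ≈ 0# → x + y ≈ y
  +-elimˡ x≈0 = ≈-trans (+-congʳ x≈0) (+-identityˡ _)

  -‿zero : ∀ {x} → x ≈ 0# → - x ≈ 0#
  -‿zero x≈0 = ≈-trans (-‿cong x≈0) ε⁻¹≈ε

  +-zero : ∀ {x y} → x ≈ 0# → y ≈ 0# → x + y ≈ 0#
  +-zero p q = ≈-trans (+-cong p q) (+-identityˡ _)

  +-cancel-neg : ∀ x y → x + (y + - x) ≈ y
  +-cancel-neg x y = ≈-trans (≈-sym (+-assoc x y (- x))) (xyx⁻¹≈y x y)

  record Linear (f : C n → C m) : Set (c ⊔ ℓ) where
    field
      cong : ∀ {Z W} → Z ≋ W → f Z ≋ f W
      homo : ∀ a Z W → f (a · Z ⊕ W) ≋ a · f Z ⊕ f W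

    zero-homo : ∀ {Z} → Z ≋ 0ᶜ → f Z ≋ 0ᶜ
    zero-homo {Z} Z≋0 p = begin
      f Z p                   ≈⟨ cong eq p ⟩
      f (- 1# · Z ⊕ Z) p      ≈⟨ homo (- 1#) Z Z p ⟩
      - 1# * f Z p + f Z p    ≈⟨ +-congʳ (-1*x≈-x (f Z p)) ⟩
      - f Z p + f Z p         ≈⟨ -‿inverseˡ (f Z p) ⟩
      0#                      ∎
      where
      -- A vanishing chain absorbs multiples of itself, so the single axiom `homo` gives
      -- `f Z = - f Z + f Z`.
      eq : Z ≋ - 1# · Z ⊕ Z
      eq q = ≈-sym (+-elimˡ (≈-trans (*-congˡ (Z≋0 q)) (zeroʳ (- 1#))))

    *-homo : ∀ a Z → f (a · Z) ≋ a · f Z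
    *-homo a Z p = begin
      f (a · Z) p             ≈⟨ cong (λ q → ≈-sym (+-identityʳ _)) p ⟩
      f (a · Z ⊕ 0ᶜ) p        ≈⟨ homo a Z 0ᶜ p ⟩
      a * f Z p + f 0ᶜ p      ≈⟨ +-elimʳ (zero-homo (λ _ → ≈-refl) p) ⟩
      a * f Z p               ∎

    ⊕-homo : ∀ Z W → f (Z ⊕ W) ≋ f Z ⊕ f W
    ⊕-homo Z W p = begin
      f (Z ⊕ W) p             ≈⟨ cong (λ q → +-congʳ (≈-sym (*-identityˡ (Z q)))) p ⟩
      f (1# · Z ⊕ W) p        ≈⟨ homo 1# Z W p ⟩
      1# * f Z p + f W p      ≈⟨ +-congʳ (*-identityˡ (f Z p)) ⟩
      f Z p + f W p           ∎

    ⊖-homo : ∀ Z → f (⊖ Z) ≋ ⊖ f Z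
    ⊖-homo Z p = begin
      f (⊖ Z) p               ≈⟨ cong (λ q → ≈-sym (-1*x≈-x (Z q))) p ⟩
      f (- 1# · Z) p          ≈⟨ *-homo (- 1#) Z p ⟩
      - 1# * f Z p            ≈⟨ -1*x≈-x (f Z p) ⟩
      - f Z p                 ∎

  open Linear public

  private
    -homo : ∀ a {x y z} → z ≈ a * x + y → - z ≈ a * - x + - y
    -homo a {x} {y} {z} eq = begin
      - z                ≈⟨ -‿cong eq ⟩
      - (a * x + y)      ≈⟨ ⁻¹-∙-comm (a * x) y ⟨
      - (a * x) + - y    ≈⟨ +-congʳ (-‿distribʳ-* a x) ⟩
      a * - x + - y      ∎

    +homo : ∀ a {x y z x′ y′ z′} → z ≈ a * x + y → z′ ≈ a * x′ + y′ →
            z + z′ ≈ a * (x + x′) + (y + y′)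
    +homo a {x} {y} {z} {x′} {y′} {z′} eq eq′ = begin
      z + z′                          ≈⟨ +-cong eq eq′ ⟩
      (a * x + y) + (a * x′ + y′)     ≈⟨ interchange (a * x) y (a * x′) y′ ⟩
      (a * x + a * x′) + (y + y′)     ≈⟨ +-congʳ (distribˡ a x x′) ⟨
      a * (x + x′) + (y + y′)         ∎

    0homo : ∀ a → 0# ≈ a * 0# + 0#
    0homo a = ≈-sym (+-zero (zeroʳ a) ≈-refl)

  id-linear : Linear {n} id
  id-linear .cong eq       = eq
  id-linear .homo a Z W p  = ≈-refl

  ∘-linear : ∀ {f : C m → C k} {g : C n → C m} → Linear f → Linear g → Linear (f ∘ g)
  ∘-linear lf lg .cong eq          = lf .cong (lg .cong eq)
  ∘-linear lf lg .homo a Z W p     = ≈-trans (lf .cong (lg .homo a Z W) p) (lf .homo a _ _ p)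

  ⊕-linear : ∀ {f g : C n → C m} → Linear f → Linear g → Linear (λ Z → f Z ⊕ g Z)
  ⊕-linear lf lg .cong eq p        = +-cong (lf .cong eq p) (lg .cong eq p)
  ⊕-linear lf lg .homo a Z W p     = +homo a (lf .homo a Z W p) (lg .homo a Z W p)

  ⊖-linear : ∀ {f : C n → C m} → Linear f → Linear (λ Z → ⊖ f Z)
  ⊖-linear lf .cong eq p           = -‿cong (lf .cong eq p)
  ⊖-linear lf .homo a Z W p        = -homo a (lf .homo a Z W p)

  ε-linear : (v : Fin n) → Linear (ε v)
  ε-linear zero    .cong eq (inside  ∷ p) = eq (outside ∷ p)
  ε-linear zero    .cong eq (outside ∷ p) = ≈-refl
  ε-linear (suc v) .cong eq (inside  ∷ p) = -‿cong (ε-linear v .cong (eq ∘ (inside ∷_)) p)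
  ε-linear (suc v) .cong eq (outside ∷ p) = ε-linear v .cong (eq ∘ (outside ∷_)) p
  ε-linear zero    .homo a Z W (inside  ∷ p) = ≈-refl
  ε-linear zero    .homo a Z W (outside ∷ p) = 0homo a
  ε-linear (suc v) .homo a Z W (inside  ∷ p) = -homo a (ε-linear v .homo a _ _ p)
  ε-linear (suc v) .homo a Z W (outside ∷ p) = ε-linear v .homo a _ _ p

  ι-linear : (v : Fin n) → Linear (ι v)
  ι-linear zero    .cong eq (inside  ∷ p) = ≈-refl
  ι-linear zero    .cong eq (outside ∷ p) = eq (inside ∷ p)
  ι-linear (suc v) .cong eq (inside  ∷ p) = -‿cong (ι-linear v .cong (eq ∘ (inside ∷_)) p)
  ι-linear (suc v) .cong eq (outside ∷ p) = ι-linear v .cong (eq ∘ (outside ∷_)) p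
  ι-linear zero    .homo a Z W (inside  ∷ p) = 0homo a
  ι-linear zero    .homo a Z W (outside ∷ p) = ≈-refl
  ι-linear (suc v) .homo a Z W (inside  ∷ p) = -homo a (ι-linear v .homo a _ _ p)
  ι-linear (suc v) .homo a Z W (outside ∷ p) = ι-linear v .homo a _ _ p

  ∂-linear : Linear (∂ {n})
  ∂-linear .cong eq []            = ≈-refl
  ∂-linear .cong eq (inside  ∷ p) = -‿cong (∂-linear .cong (eq ∘ (inside ∷_)) p)
  ∂-linear .cong eq (outside ∷ p) = +-cong (eq (inside ∷ p)) (∂-linear .cong (eq ∘ (outside ∷_)) p)
  ∂-linear .homo a Z W []            = 0homo a
  ∂-linear .homo a Z W (inside  ∷ p) = -homo a (∂-linear .homo a _ _ p)
  ∂-linear .homo a Z W (outside ∷ p) = +homo a ≈-refl (∂-linear .homo a _ _ p)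

  -- Coning over `v` is a contracting homotopy of the augmented complex of the full simplex.
  ∂ε+ε∂ : (v : Fin n) (Z : C n) → ∂ (ε v Z) ⊕ ε v (∂ Z) ≋ Z
  ∂ε+ε∂ zero Z (inside ∷ p) = begin
    - x + (Z (inside ∷ p) + x)   ≈⟨ x∙yz≈y∙xz (- x) (Z (inside ∷ p)) x ⟩
    Z (inside ∷ p) + (- x + x)   ≈⟨ +-elimʳ (-‿inverseˡ x) ⟩
    Z (inside ∷ p)               ∎
    where x = ∂ (Z ∘ (outside ∷_)) p
  ∂ε+ε∂ zero Z (outside ∷ p) =
    ≈-trans (+-identityʳ _) (+-elimʳ (zero-homo ∂-linear (λ _ → ≈-refl) p))
  ∂ε+ε∂ (suc v) Z (inside ∷ p) = begin
    - ∂ (⊖ ε v Zᵢ) p + - ε v (⊖ ∂ Zᵢ) p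
      ≈⟨ +-cong (-‿cong (⊖-homo ∂-linear (ε v Zᵢ) p)) (-‿cong (⊖-homo (ε-linear v) (∂ Zᵢ) p)) ⟩
    - - ∂ (ε v Zᵢ) p + - - ε v (∂ Zᵢ) p
      ≈⟨ +-cong (⁻¹-involutive _) (⁻¹-involutive _) ⟩
    ∂ (ε v Zᵢ) p + ε v (∂ Zᵢ) p
      ≈⟨ ∂ε+ε∂ v Zᵢ p ⟩
    Zᵢ p ∎
    where Zᵢ = Z ∘ (inside ∷_)
  ∂ε+ε∂ (suc v) Z (outside ∷ p) = begin
    (- x + y) + ε v (Zᵢ ⊕ ∂ Zₒ) p   ≈⟨ +-congˡ (⊕-homo (ε-linear v) Zᵢ (∂ Zₒ) p) ⟩
    (- x + y) + (x + z)             ≈⟨ interchange (- x) y x z ⟩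
    (- x + x) + (y + z)             ≈⟨ +-elimˡ (-‿inverseˡ x) ⟩
    y + z                           ≈⟨ ∂ε+ε∂ v Zₒ p ⟩
    Zₒ p                            ∎
    where
    Zᵢ = Z ∘ (inside ∷_)
    Zₒ = Z ∘ (outside ∷_)
    x = ε v Zᵢ p
    y = ∂ (ε v Zₒ) p
    z = ε v (∂ Zₒ) p

  -- The boundary is a sum of contractions, and contractions anticommute.
  ∂ι+ι∂ : (v : Fin n) (Z : C n) → ∂ (ι v Z) ⊕ ι v (∂ Z) ≋ 0ᶜ
  ∂ι+ι∂ zero Z (inside ∷ p) =
    +-zero (-‿zero (zero-homo ∂-linear (λ _ → ≈-refl) p)) ≈-refl
  ∂ι+ι∂ zero Z (outside ∷ p) = ≈-trans (+-congʳ (+-identityˡ _)) (-‿inverseʳ _)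
  ∂ι+ι∂ (suc v) Z (inside ∷ p) = begin
    - ∂ (⊖ ι v Zᵢ) p + - ι v (⊖ ∂ Zᵢ) p
      ≈⟨ +-cong (-‿cong (⊖-homo ∂-linear (ι v Zᵢ) p)) (-‿cong (⊖-homo (ι-linear v) (∂ Zᵢ) p)) ⟩
    - - ∂ (ι v Zᵢ) p + - - ι v (∂ Zᵢ) p
      ≈⟨ +-cong (⁻¹-involutive _) (⁻¹-involutive _) ⟩
    ∂ (ι v Zᵢ) p + ι v (∂ Zᵢ) p
      ≈⟨ ∂ι+ι∂ v Zᵢ p ⟩
    0# ∎
    where Zᵢ = Z ∘ (inside ∷_)
  ∂ι+ι∂ (suc v) Z (outside ∷ p) = begin
    (- x + y) + ι v (Zᵢ ⊕ ∂ Zₒ) p   ≈⟨ +-congˡ (⊕-homo (ι-linear v) Zᵢ (∂ Zₒ) p) ⟩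
    (- x + y) + (x + z)             ≈⟨ interchange (- x) y x z ⟩
    (- x + x) + (y + z)             ≈⟨ +-zero (-‿inverseˡ x) (∂ι+ι∂ v Zₒ p) ⟩
    0#                              ∎
    where
    Zᵢ = Z ∘ (inside ∷_)
    Zₒ = Z ∘ (outside ∷_)
    x = ι v Zᵢ p
    y = ∂ (ι v Zₒ) p
    z = ι v (∂ Zₒ) p

  ∂∂≋0 : (Z : C n) → ∂ (∂ Z) ≋ 0ᶜ
  ∂∂≋0 Z []            = ≈-refl
  ∂∂≋0 Z (inside  ∷ p) =
    -‿zero (≈-trans (⊖-homo ∂-linear (∂ (Z ∘ (inside ∷_))) p) (-‿zero (∂∂≋0 (Z ∘ (inside ∷_)) p)))
  ∂∂≋0 Z (outside ∷ p) = begin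
    - x + ∂ (Zᵢ ⊕ ∂ Zₒ) p       ≈⟨ +-congˡ (⊕-homo ∂-linear Zᵢ (∂ Zₒ) p) ⟩
    - x + (x + ∂ (∂ Zₒ) p)      ≈⟨ +-congˡ (+-elimʳ (∂∂≋0 Zₒ p)) ⟩
    - x + x                     ≈⟨ -‿inverseˡ x ⟩
    0#                          ∎
    where
    Zᵢ = Z ∘ (inside ∷_)
    Zₒ = Z ∘ (outside ∷_)
    x = ∂ Zᵢ p

  ε-outside : (v : Fin n) (Z : C n) (p : Subset n) → lookup p v ≡ outside → ε v Z p ≈ 0#
  ε-outside zero    Z (outside ∷ p) eq = ≈-refl
  ε-outside (suc v) Z (inside  ∷ p) eq = -‿zero (ε-outside v _ p eq)
  ε-outside (suc v) Z (outside ∷ p) eq = ε-outside v _ p eq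

  ε-support : (v : Fin n) (Z : C n) (p : Subset n) → Z (p [ v ]≔ outside) ≈ 0# → ε v Z p ≈ 0#
  ε-support zero    Z (inside  ∷ p) eq = eq
  ε-support zero    Z (outside ∷ p) eq = ≈-refl
  ε-support (suc v) Z (inside  ∷ p) eq = -‿zero (ε-support v _ p eq)
  ε-support (suc v) Z (outside ∷ p) eq = ε-support v _ p eq

  ι-support : (v : Fin n) (Z : C n) (p : Subset n) → Z (p [ v ]≔ inside) ≈ 0# → ι v Z p ≈ 0#
  ι-support zero    Z (inside  ∷ p) eq = ≈-refl
  ι-support zero    Z (outside ∷ p) eq = eq
  ι-support (suc v) Z (inside  ∷ p) eq = -‿zero (ι-support v _ p eq)
  ι-support (suc v) Z (outside ∷ p) eq = ι-support v _ p eq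

  ∂-support : (Z : C n) (p : Subset n) →
              (∀ v → lookup p v ≡ outside → Z (p [ v ]≔ inside) ≈ 0#) → ∂ Z p ≈ 0#
  ∂-support Z []            h = ≈-refl
  ∂-support Z (inside  ∷ p) h = -‿zero (∂-support _ p (h ∘ suc))
  ∂-support Z (outside ∷ p) h = +-zero (h zero refl) (∂-support _ p (h ∘ suc))

  -- Removing and restoring `v` incur the same sign twice; with `ε-outside`, this makes `ε v ∘ ι v`
  -- the projection onto faces containing `v`.
  ει-inside : (v : Fin n) (Z : C n) (p : Subset n) → lookup p v ≡ inside → ε v (ι v Z) p ≈ Z p
  ει-inside zero    Z (inside  ∷ p) eq = ≈-refl
  ει-inside (suc v) Z (inside  ∷ p) eq = begin
    - ε v (⊖ ι v (Z ∘ (inside ∷_))) p   ≈⟨ -‿cong (⊖-homo (ε-linear v) _ p) ⟩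
    - - ε v (ι v (Z ∘ (inside ∷_))) p   ≈⟨ ⁻¹-involutive _ ⟩
    ε v (ι v (Z ∘ (inside ∷_))) p       ≈⟨ ει-inside v _ p eq ⟩
    Z (inside ∷ p)                      ∎
  ει-inside (suc v) Z (outside ∷ p) eq = ει-inside v _ p eq

  ι-inside : (v : Fin n) (Z : C n) (p : Subset n) → lookup p v ≡ inside → ι v Z p ≈ 0#
  ι-inside zero    Z (inside  ∷ p) eq = ≈-refl
  ι-inside (suc v) Z (inside  ∷ p) eq = -‿zero (ι-inside v _ p eq)
  ι-inside (suc v) Z (outside ∷ p) eq = ι-inside v _ p eq

  -- Exchanging vertices: chain maps and their prism homotopies.

  Avoids : Fin n → C n → Set ℓ
  Avoids v Z = ∀ p → lookup p v ≡ inside → Z p ≈ 0#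

  -- The chain map induced by the vertex map sending a to b and fixing all other vertices.
  replace : Fin n → Fin n → C n → C n
  replace a b Z = Z ⊕ (ε b (ι a Z) ⊕ ⊖ ε a (ι a Z))

  replace-linear : (a b : Fin n) → Linear (replace a b)
  replace-linear a b = ⊕-linear id-linear
    (⊕-linear (∘-linear (ε-linear b) (ι-linear a)) (⊖-linear (∘-linear (ε-linear a) (ι-linear a))))

  ∂-ε : (v : Fin n) (Z : C n) → ∂ (ε v Z) ≋ Z ⊕ ⊖ ε v (∂ Z)
  ∂-ε v Z p = begin
    x                    ≈⟨ +-cancel-neg y x ⟨
    y + (x + - y)        ≈⟨ x∙yz≈y∙xz y x (- y) ⟩
    x + (y + - y)        ≈⟨ +-assoc x y (- y) ⟨
    x + y + - y          ≈⟨ +-congʳ (∂ε+ε∂ v Z p) ⟩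
    Z p + - y            ∎
    where
    x = ∂ (ε v Z) p
    y = ε v (∂ Z) p

  ∂-ι : (v : Fin n) (Z : C n) → ∂ (ι v Z) ≋ ⊖ ι v (∂ Z)
  ∂-ι v Z p = inverseˡ-unique _ _ (∂ι+ι∂ v Z p)

  -- Coning `ι a Z` over `a` or over `b` fails to commute with the boundary by the same term
  -- `ι a Z`, which cancels in the difference.
  ∂-replace : (a b : Fin n) (Z : C n) → ∂ (replace a b Z) ≋ replace a b (∂ Z)
  ∂-replace a b Z p = begin
    ∂ (replace a b Z) p
      ≈⟨ ⊕-homo ∂-linear Z _ p ⟩
    ∂ Z p + ∂ (ε b X ⊕ ⊖ ε a X) p
      ≈⟨ +-congˡ (⊕-homo ∂-linear (ε b X) (⊖ ε a X) p) ⟩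
    ∂ Z p + (∂ (ε b X) p + ∂ (⊖ ε a X) p)
      ≈⟨ +-congˡ (+-congˡ (⊖-homo ∂-linear (ε a X) p)) ⟩
    ∂ Z p + (∂ (ε b X) p + - ∂ (ε a X) p)
      ≈⟨ +-congˡ (+-cong (step b) (-‿cong (step a))) ⟩
    ∂ Z p + ((X p + y b) + - (X p + y a))
      ≈⟨ +-congˡ (cancel (X p) (y b) (y a)) ⟩
    ∂ Z p + (y b + - y a) ∎
    where
    X = ι a Z
    y : Fin _ → Carrier
    y v = ε v (ι a (∂ Z)) p
    step : ∀ v → ∂ (ε v X) p ≈ X p + y v
    step v = begin
      ∂ (ε v X) p                     ≈⟨ ∂-ε v X p ⟩
      X p + - ε v (∂ X) p             ≈⟨ +-congˡ (-‿cong (ε-linear v .cong (∂-ι a Z) p)) ⟩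
      X p + - ε v (⊖ ι a (∂ Z)) p     ≈⟨ +-congˡ (-‿cong (⊖-homo (ε-linear v) _ p)) ⟩
      X p + - - y v                   ≈⟨ +-congˡ (⁻¹-involutive (y v)) ⟩
      X p + y v                       ∎
    cancel : ∀ x y z → (x + y) + - (x + z) ≈ y + - z
    cancel x y z = begin
      (x + y) + - (x + z)     ≈⟨ +-congˡ (⁻¹-∙-comm x z) ⟨
      (x + y) + (- x + - z)   ≈⟨ interchange x y (- x) (- z) ⟩
      (x + - x) + (y + - z)   ≈⟨ +-elimˡ (-‿inverseʳ x) ⟩
      y + - z                 ∎

  replace-fixes : ∀ {a} b {Z : C n} → Avoids a Z → replace a b Z ≋ Z
  replace-fixes {a = a} b {Z} avoids p =
    +-elimʳ (+-zero (zero-homo (ε-linear b) ιZ≋0 p) (-‿zero (zero-homo (ε-linear a) ιZ≋0 p)))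
    where
    ιZ≋0 : ι a Z ≋ 0ᶜ
    ιZ≋0 q = ι-support a Z q (avoids _ (lookup∘update a q inside))

  -- On a face containing `a`, the cone over `b` contributes nothing, and the cone over `a` restores
  -- `Z` with a minus sign.
  replace-source : ∀ {a b} (Z : C n) → a ≢ b → Avoids a (replace a b Z)
  replace-source {a = a} {b} Z a≢b p a∈p = begin
    Z p + (ε b (ι a Z) p + - ε a (ι a Z) p)
      ≈⟨ +-congˡ (+-cong (ε-support b _ p (ι-inside a Z _ a∈p′)) (-‿cong (ει-inside a Z p a∈p))) ⟩
    Z p + (0# + - Z p)
      ≈⟨ +-cancel-neg (Z p) 0# ⟩
    0# ∎
    where a∈p′ = ≡.trans (lookup∘update′ a≢b p outside) a∈p

  replace-avoids : ∀ {v a b} {Z : C n} → v ≢ b → Avoids v Z → Avoids v (replace a b Z)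
  replace-avoids {v = v} {a} {b} {Z} v≢b avoids p v∈p =
    +-zero (avoids p v∈p) (+-zero (ε-support b _ p (ι-support a Z _ (avoids _ v∈₁)))
                            (-‿zero (ε-support a _ p (ι-support a Z _ (avoids _ v∈₂)))))
    where
    v∈₁ = ⊑-insert a (p [ b ]≔ outside) v (≡.trans (lookup∘update′ v≢b p outside) v∈p)
    v∈₂ : lookup ((p [ a ]≔ outside) [ a ]≔ inside) v ≡ inside
    v∈₂ with v ≟ a
    ... | yes refl = lookup∘update v (p [ v ]≔ outside) inside
    ... | no v≢a   = ⊑-insert a (p [ a ]≔ outside) v (≡.trans (lookup∘update′ v≢a p outside) v∈p)

  -- `ε a (ε b (ι a Z))` is the prism swept out when `a` moves to `b`; expanding its boundary uses
  -- `∂-ε` twice. The error term on the right is, up to sign, the prism of `∂ Z`, and it lives on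
  -- faces containing both `a` and `b`.
  replace-homotopy : (a b : Fin n) (Z : C n) →
    Z ⊕ ∂ (ε a (ε b (ι a Z))) ≋ replace a b Z ⊕ ε a (ε b (∂ (ι a Z)))
  replace-homotopy a b Z p = begin
    Z p + ∂ (ε a (ε b X)) p
      ≈⟨ +-congˡ (∂-ε a (ε b X) p) ⟩
    Z p + (ε b X p + - ε a (∂ (ε b X)) p)
      ≈⟨ +-congˡ (+-congˡ (-‿cong (ε-linear a .cong (∂-ε b X) p))) ⟩
    Z p + (ε b X p + - ε a (X ⊕ ⊖ ε b (∂ X)) p)
      ≈⟨ +-congˡ (+-congˡ (-‿cong (⊕-homo (ε-linear a) X (⊖ ε b (∂ X)) p))) ⟩
    Z p + (ε b X p + - (ε a X p + ε a (⊖ ε b (∂ X)) p))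
      ≈⟨ +-congˡ (+-congˡ (⁻¹-∙-comm _ _)) ⟨
    Z p + (ε b X p + (- ε a X p + - ε a (⊖ ε b (∂ X)) p))
      ≈⟨ +-congˡ (+-congˡ (+-congˡ (-‿cong (⊖-homo (ε-linear a) (ε b (∂ X)) p)))) ⟩
    Z p + (ε b X p + (- ε a X p + - - y))
      ≈⟨ +-congˡ (+-congˡ (+-congˡ (⁻¹-involutive y))) ⟩
    Z p + (ε b X p + (- ε a X p + y))
      ≈⟨ +-congˡ (+-assoc _ _ _) ⟨
    Z p + (ε b X p + - ε a X p + y)
      ≈⟨ +-assoc _ _ _ ⟨
    Z p + (ε b X p + - ε a X p) + y ∎
    where
    X = ι a Z
    y = ε a (ε b (∂ X)) p

  replaceAll : (Fin m → Fin n) → (Fin m → Fin n) → C n → C n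
  replaceAll {zero}  a b Z = Z
  replaceAll {suc m} a b Z = replaceAll (a ∘ suc) (b ∘ suc) (replace (a zero) (b zero) Z)

  replaceAll-linear : (a b : Fin m → Fin n) → Linear (replaceAll a b)
  replaceAll-linear {zero}  a b = id-linear
  replaceAll-linear {suc m} a b =
    ∘-linear (replaceAll-linear (a ∘ suc) (b ∘ suc)) (replace-linear (a zero) (b zero))

  ∂-replaceAll : (a b : Fin m → Fin n) (Z : C n) → ∂ (replaceAll a b Z) ≋ replaceAll a b (∂ Z)
  ∂-replaceAll {zero}  a b Z p = ≈-refl
  ∂-replaceAll {suc m} a b Z p = ≈-trans (∂-replaceAll (a ∘ suc) (b ∘ suc) _ p)
    (replaceAll-linear (a ∘ suc) (b ∘ suc) .cong (∂-replace (a zero) (b zero) Z) p)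

  replaceAll-fixes : (a b : Fin m → Fin n) {Z : C n} → (∀ i → Avoids (a i) Z) →
                     replaceAll a b Z ≋ Z
  replaceAll-fixes {zero}  a b avoids p = ≈-refl
  replaceAll-fixes {suc m} a b avoids p = ≈-trans
    (replaceAll-linear (a ∘ suc) (b ∘ suc) .cong (replace-fixes (b zero) (avoids zero)) p)
    (replaceAll-fixes (a ∘ suc) (b ∘ suc) (avoids ∘ suc) p)

  replaceAll-avoids : ∀ (a b : Fin m → Fin n) {v} {Z : C n} → (∀ j → v ≢ b j) →
                      Avoids v Z → Avoids v (replaceAll a b Z)
  replaceAll-avoids {zero}  a b v≢b avoids = avoids
  replaceAll-avoids {suc m} a b {v} {Z} v≢b avoids =
    replaceAll-avoids (a ∘ suc) (b ∘ suc) (v≢b ∘ suc) (replace-avoids {a = a zero} {Z = Z} (v≢b zero) avoids)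

  -- Each source disappears at its own exchange and cannot return, because no later target equals
  -- it.
  replaceAll-sources : (a b : Fin m → Fin n) (Z : C n) → (∀ i j → a i ≢ b j) →
                       ∀ i → Avoids (a i) (replaceAll a b Z)
  replaceAll-sources {suc m} a b Z a≢b zero    =
    replaceAll-avoids (a ∘ suc) (b ∘ suc) (a≢b zero ∘ suc) (replace-source Z (a≢b zero zero))
  replaceAll-sources {suc m} a b Z a≢b (suc i) =
    replaceAll-sources (a ∘ suc) (b ∘ suc) _ (λ i j → a≢b (suc i) (suc j)) i

  -- The complement of the degenerate faces: a face that fails this contains some pair `a i`, `b i`.
  Transversal : (a b : Fin m → Fin n) → Subset n → Set
  Transversal a b p = ∀ i → lookup p (a i) ≡ inside → lookup p (b i) ≡ outside

  homotopy : (a b : Fin m → Fin n) → C n → C n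
  homotopy {zero}  a b Z = 0ᶜ
  homotopy {suc m} a b Z = ε (a zero) (ε (b zero) (ι (a zero) Z)) ⊕
                           homotopy (a ∘ suc) (b ∘ suc) (replace (a zero) (b zero) Z)

  homotopy-linear : (a b : Fin m → Fin n) → Linear (homotopy a b)
  homotopy-linear {zero}  a b .cong eq p      = ≈-refl
  homotopy-linear {zero}  a b .homo x Z W p   = 0homo x
  homotopy-linear {suc m} a b = ⊕-linear
    (∘-linear (ε-linear (a zero)) (∘-linear (ε-linear (b zero)) (ι-linear (a zero))))
    (∘-linear (homotopy-linear (a ∘ suc) (b ∘ suc)) (replace-linear (a zero) (b zero)))

  -- The identities `replace-homotopy` for the successive exchanges telescope. Each error term lives
  -- on faces containing both members of one pair, so it vanishes at a transversal face.
  ∂-homotopy : (a b : Fin m → Fin n) (Z : C n) (p : Subset n) → (∀ i j → a i ≢ b j) →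
               Transversal a b p → Z p + ∂ (homotopy a b Z) p ≈ replaceAll a b Z p
  ∂-homotopy {zero}  a b Z p a≢b tr = +-elimʳ (zero-homo ∂-linear (λ _ → ≈-refl) p)
  ∂-homotopy {suc m} a b Z p a≢b tr = begin
    Z p + ∂ (H ⊕ K) p
      ≈⟨ +-congˡ (⊕-homo ∂-linear H K p) ⟩
    Z p + (∂ H p + ∂ K p)
      ≈⟨ +-assoc _ _ _ ⟨
    Z p + ∂ H p + ∂ K p
      ≈⟨ +-congʳ (replace-homotopy a₀ b₀ Z p) ⟩
    replace a₀ b₀ Z p + ε a₀ (ε b₀ (∂ (ι a₀ Z))) p + ∂ K p
      ≈⟨ +-congʳ (+-elimʳ degenerate) ⟩
    replace a₀ b₀ Z p + ∂ K p
      ≈⟨ ∂-homotopy (a ∘ suc) (b ∘ suc) _ p (λ i j → a≢b (suc i) (suc j)) (tr ∘ suc) ⟩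
    replaceAll a b Z p ∎
    where
    a₀ = a zero
    b₀ = b zero
    H = ε a₀ (ε b₀ (ι a₀ Z))
    K = homotopy (a ∘ suc) (b ∘ suc) (replace a₀ b₀ Z)
    degenerate : ε a₀ (ε b₀ (∂ (ι a₀ Z))) p ≈ 0#
    degenerate with lookup p a₀ in eq
    ... | false = ε-outside a₀ _ p eq
    ... | true  = ε-support a₀ _ p (ε-outside b₀ _ _
      (≡.trans (lookup∘update′ (a≢b zero zero ∘ ≡.sym) p outside) (tr zero eq)))

  -- One pair is collapsed at a time, and the result must vanish on faces transversal to the
  -- remaining pairs. At such a face containing `b₀` this is `replace-source`. Otherwise only the
  -- values of `Z` at the face itself and at the face with `a₀` exchanged for `b₀` enter, and both
  -- faces are transversal to all pairs. Once no pair is left, every face is transversal.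
  replaceAll-kills : (a b : Fin m → Fin n) (Z : C n) →
    (∀ {i j} → a i ≡ a j → i ≡ j) → (∀ {i j} → b i ≡ b j → i ≡ j) → (∀ i j → a i ≢ b j) →
    (∀ p → Transversal a b p → Z p ≈ 0#) → replaceAll b a Z ≋ 0ᶜ
  replaceAll-kills {zero}  a b Z a-inj b-inj a≢b supp p = supp p λ ()
  replaceAll-kills {suc m} a b Z a-inj b-inj a≢b supp =
    replaceAll-kills (a ∘ suc) (b ∘ suc) _ (suc-injective ∘ a-inj) (suc-injective ∘ b-inj)
      (λ i j → a≢b (suc i) (suc j)) supp′
    where
    a₀ = a zero
    b₀ = b zero
    supp′ : ∀ p → Transversal (a ∘ suc) (b ∘ suc) p → replace b₀ a₀ Z p ≈ 0#
    supp′ p tr with lookup p b₀ in eq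
    ... | true  = replace-source Z (a≢b zero zero ∘ ≡.sym) p eq
    ... | false = +-zero (supp p trans₁) (+-zero (ε-support a₀ _ p (ι-support b₀ Z _ (supp _ trans₂)))
                                           (-‿zero (ε-outside b₀ _ p eq)))
      where
      trans₁ : Transversal a b p
      trans₁ zero    _ = eq
      trans₁ (suc i) h = tr i h
      q = p [ a₀ ]≔ outside
      trans₂ : Transversal a b (q [ b₀ ]≔ inside)
      trans₂ zero    h = contradiction
        (≡.trans (≡.sym h) (≡.trans (lookup∘update′ (a≢b zero zero) q inside) (lookup∘update a₀ p outside)))
        λ ()
      trans₂ (suc i) h =
        ≡.trans (unchanged (λ e → a≢b zero (suc i) (≡.sym e)) (λ e → 1+≢0 (b-inj e)))
          (tr i (≡.trans (≡.sym (unchanged (λ e → 1+≢0 (a-inj e)) (a≢b (suc i) zero))) h))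
        where
        1+≢0 : ∀ {i : Fin m} → suc i ≢ zero
        1+≢0 ()
        unchanged : ∀ {v} → v ≢ a₀ → v ≢ b₀ → lookup (q [ b₀ ]≔ inside) v ≡ lookup p v
        unchanged v≢a v≢b = ≡.trans (lookup∘update′ v≢b q inside) (lookup∘update′ v≢a p outside)

  -- Linear combinations and linear dependence without decidable equality of scalars.

  comb : (Fin m → Carrier) → (Fin m → C n) → C n
  comb λs x p = sum (λ i → λs i * x i p)

  linear-comb : ∀ {f : C n → C k} → Linear f → (λs : Fin m → Carrier) (x : Fin m → C n) →
                f (comb λs x) ≋ comb λs (f ∘ x)
  linear-comb {m = zero}  lf λs x p = zero-homo lf (λ _ → ≈-refl) p
  linear-comb {m = suc m} lf λs x p = ≈-trans (lf .homo (λs zero) (x zero) _ p)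
    (+-congˡ (linear-comb lf (λs ∘ suc) (x ∘ suc) p))

  sum-zero : ∀ {f : Fin m → Carrier} → (∀ i → f i ≈ 0#) → sum f ≈ 0#
  sum-zero {m = m} f≈0 = ≈-trans (sum-cong-≋ f≈0) (sum-replicate-zero m)

  comb-zero : ∀ (λs : Fin m → Carrier) (x : Fin m → C n) {p} → (∀ i → x i p ≈ 0#) → comb λs x p ≈ 0#
  comb-zero λs x x≈0 = sum-zero λ i → ≈-trans (*-congˡ (x≈0 i)) (zeroʳ (λs i))

  ¬¬-∀ : ∀ {a} {P : Fin m → Set a} → (∀ i → ¬ ¬ P i) → ¬ ¬ (∀ i → P i)
  ¬¬-∀ {m = zero}  h k = k λ ()
  ¬¬-∀ {m = suc m} h k = h zero λ p₀ → ¬¬-∀ (h ∘ suc) λ ps → k λ { zero → p₀ ; (suc i) → ps i }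

  -- A nonzero entry divides all the others; if all entries vanish, index `zero` with ratios 0
  -- works. This case distinction on scalars is available only under double negation.
  pivot : (y : Fin (suc m) → Carrier) →
    ¬ ¬ ∃ λ i → ∃ λ (r : Fin m → Carrier) → ∀ j → y (punchIn i j) ≈ r j * y i
  pivot y k = ¬¬-∀ {P = λ i → y i ≈ 0#} nonpivot
    λ y≈0 → k (zero , (λ _ → 0#) , λ j → ≈-trans (y≈0 (suc j)) (≈-sym (zeroˡ _)))
    where
    nonpivot : ∀ i → ¬ ¬ (y i ≈ 0#)
    nonpivot i yᵢ≉0 = k (i , (λ j → y (punchIn i j) * y⁻¹) , λ j → ≈-sym (begin
      y (punchIn i j) * y⁻¹ * y i     ≈⟨ *-assoc _ _ _ ⟩
      y (punchIn i j) * (y⁻¹ * y i)   ≈⟨ *-congˡ (proj₁ (proj₂ (invertible (y i) yᵢ≉0))) ⟩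
      y (punchIn i j) * 1#            ≈⟨ *-identityʳ _ ⟩
      y (punchIn i j)                 ∎))
      where y⁻¹ = proj₁ (invertible (y i) yᵢ≉0)

  -- Gaussian elimination: fewer homogeneous equations than unknowns have a nontrivial solution. A
  -- pivot at `s` clears the value there from the other vectors, and the recursion treats the
  -- remaining equations with one vector fewer.
  dependence : (x : Fin m → C n) (S : List (Subset n)) → length S < m →
    ¬ ¬ ∃ λ λs → (∃ λ i → ¬ (λs i ≈ 0#)) × All (λ p → comb λs x p ≈ 0#) S
  dependence {suc m} x []      _         k = k ((λ _ → 1#) , (zero , 0≉1 ∘ ≈-sym) , [])
  dependence {suc m} x (s ∷ S) (s≤s S<m) k = pivot (λ i → x i s) λ where
    (i₀ , r , eq) →
      let x′ : Fin m → C _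
          x′ j = x (punchIn i₀ j) ⊕ (- r j · x i₀)
          extend : (Fin m → Carrier) → Fin (suc m) → Carrier
          -- Expanding `comb μ x′` collects a multiple `- r j` of `x i₀` from every `j`; this sum is
          -- its total coefficient.
          extend μ = insertAt μ i₀ (sum λ j → μ j * - r j)
          comb-extend : ∀ μ p → comb (extend μ) x p ≈ comb μ x′ p
          comb-extend μ p = begin
            comb (extend μ) x p
              ≈⟨ sum-remove {i = i₀} (λ i → extend μ i * x i p) ⟩
            extend μ i₀ * x i₀ p + sum (λ j → extend μ (punchIn i₀ j) * x (punchIn i₀ j) p)
              ≈⟨ +-cong (*-congʳ (reflexive (insertAt-lookup μ i₀ _)))
                        (sum-cong-≋ λ j → *-congʳ (reflexive (insertAt-punchIn μ i₀ _ j))) ⟩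
            (sum λ j → μ j * - r j) * x i₀ p + sum (λ j → μ j * x (punchIn i₀ j) p)
              ≈⟨ +-congʳ (*-distribʳ-sum (x i₀ p) (λ j → μ j * - r j)) ⟩
            sum (λ j → μ j * - r j * x i₀ p) + sum (λ j → μ j * x (punchIn i₀ j) p)
              ≈⟨ +-comm _ _ ⟩
            sum (λ j → μ j * x (punchIn i₀ j) p) + sum (λ j → μ j * - r j * x i₀ p)
              ≈⟨ ∑-distrib-+ (λ j → μ j * x (punchIn i₀ j) p) (λ j → μ j * - r j * x i₀ p) ⟨
            sum (λ j → μ j * x (punchIn i₀ j) p + μ j * - r j * x i₀ p)
              ≈⟨ sum-cong-≋ (λ j → ≈-trans (+-congˡ (*-assoc _ _ _)) (≈-sym (distribˡ (μ j) _ _))) ⟩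
            comb μ x′ p ∎
          x′s≈0 : ∀ j → x′ j s ≈ 0#
          x′s≈0 j = ≈-trans (+-cong (eq j) (≈-sym (-‿distribˡ-* (r j) (x i₀ s)))) (-‿inverseʳ _)
      in dependence x′ S S<m λ where
        (μ , (j , μⱼ≉0) , zeros) → k (extend μ
          , (punchIn i₀ j , μⱼ≉0 ∘ ≈-trans (reflexive (≡.sym (insertAt-punchIn μ i₀ _ j))))
          , ≈-trans (comb-extend μ s) (comb-zero μ x′ x′s≈0)
            ∷ All.map (λ {p} → ≈-trans (comb-extend μ p)) zeros)

-- Agreement of the recursive boundary with the signed sum over faces.

module BoundaryBridge {c ℓ} (F : Field c ℓ) where
  open ExteriorAlgebra F
  open Chains F using (∂-simplex) renaming (∂ to ∂ᶠ)
  open Exp semiring using (_^_)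

  ΣL : ∀ {a} {A : Set a} → (A → Carrier) → List A → Carrier
  ΣL f = foldr (λ x s → f x + s) 0#

  ΣL-cong : ∀ {a} {A : Set a} {f g : A → Carrier} → (∀ x → f x ≈ g x) → ∀ xs → ΣL f xs ≈ ΣL g xs
  ΣL-cong eq []       = ≈-refl
  ΣL-cong eq (x ∷ xs) = +-cong (eq x) (ΣL-cong eq xs)

  ΣL-zero : ∀ {a} {A : Set a} {f : A → Carrier} → (∀ x → f x ≈ 0#) → ∀ xs → ΣL f xs ≈ 0#
  ΣL-zero eq []       = ≈-refl
  ΣL-zero eq (x ∷ xs) = +-zero (eq x) (ΣL-zero eq xs)

  ΣL-neg : ∀ {a} {A : Set a} (f : A → Carrier) xs → ΣL (-_ ∘ f) xs ≈ - ΣL f xs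
  ΣL-neg f []       = ≈-sym ε⁻¹≈ε
  ΣL-neg f (x ∷ xs) = ≈-trans (+-congˡ (ΣL-neg f xs)) (⁻¹-∙-comm _ _)

  ΣL-++-map : ∀ {a b} {A B : Set a} {D : Set b} (f : D → Carrier) (g : A → D) (h : B → D) xs ys →
              ΣL f (map g xs ++ map h ys) ≈ ΣL (f ∘ g) xs + ΣL (f ∘ h) ys
  ΣL-++-map f g h []       ys = ≈-trans (ΣL-map ys) (≈-sym (+-identityˡ _))
    where
    ΣL-map : ∀ ys → ΣL f (map h ys) ≈ ΣL (f ∘ h) ys
    ΣL-map []       = ≈-refl
    ΣL-map (y ∷ ys) = +-congˡ (ΣL-map ys)
  ΣL-++-map f g h (x ∷ xs) ys = ≈-trans (+-congˡ (ΣL-++-map f g h xs ys)) (≈-sym (+-assoc _ _ _))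

  indicator : Subset n → C n
  indicator q p = if does (≡-dec Bool._≟_ p q) then 1# else 0#

  indicator-refl : (p : Subset n) → indicator p p ≈ 1#
  indicator-refl p with ≡-dec Bool._≟_ p p
  ... | yes _  = ≈-refl
  ... | no p≢p = contradiction refl p≢p

  indicator-≢ : {p q : Subset n} → p ≢ q → indicator q p ≈ 0#
  indicator-≢ {p = p} {q} p≢q with ≡-dec Bool._≟_ p q
  ... | yes p≡q = contradiction p≡q p≢q
  ... | no _    = ≈-refl

  -- `faces` lists each face exactly once, so a single term survives.
  ΣL-indicator : (Z : C n) (τ : Face n k) →
    ΣL (λ σ → Z (vertices σ) * indicator (vertices τ) (vertices σ)) (faces n k) ≈ Z (vertices τ)
  ΣL-indicator {zero}  {zero}  Z (mkFace [] _)            = ≈-trans (+-identityʳ _) (*-identityʳ _)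
  ΣL-indicator {zero}  {suc k} Z (mkFace [] e)            = ⊥-elim-irr (ℕ.0≢1+n e)
  ΣL-indicator {suc n} {zero}  Z (mkFace (inside  ∷ p) e) = ⊥-elim-irr (ℕ.1+n≢0 e)
  ΣL-indicator {suc n} {zero}  Z (mkFace (outside ∷ p) e) = ≈-trans
    (ΣL-++-map {A = Face n zero} _ addOutside addOutside [] (faces n zero))
    (≈-trans (+-identityˡ _) (ΣL-indicator (Z ∘ (outside ∷_)) (mkFace p e)))
  ΣL-indicator {suc n} {suc k} Z (mkFace (inside  ∷ p) e) = ≈-trans
    (ΣL-++-map _ addInside addOutside (faces n k) (faces n (suc k)))
    (≈-trans (+-elimʳ (ΣL-zero (λ _ → zeroʳ _) (faces n (suc k))))
             (ΣL-indicator (Z ∘ (inside ∷_)) (mkFace p (ℕ.suc-injective e))))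
  ΣL-indicator {suc n} {suc k} Z (mkFace (outside ∷ p) e) = ≈-trans
    (ΣL-++-map _ addInside addOutside (faces n k) (faces n (suc k)))
    (≈-trans (+-elimˡ (ΣL-zero (λ _ → zeroʳ _) (faces n k)))
             (ΣL-indicator (Z ∘ (outside ∷_)) (mkFace p e)))

  coefficient : Subset n → Subset n → Fin n → Carrier
  coefficient p q v = if does (v ∈? p) ∧ does (≡-dec Bool._≟_ (p - v) q) then (- 1#) ^ rank p v else 0#

  coefficient-∧-false : (p q : Subset n) (v : Fin n) → does (≡-dec Bool._≟_ (p - v) q) ≡ false →
                        coefficient p q v ≈ 0#
  coefficient-∧-false p q v eq rewrite eq with does (v ∈? p)
  ... | true  = ≈-refl
  ... | false = ≈-refl

  -- The vertex 0 raises the rank of every later vertex by one, hence the extra sign.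
  coefficient-inside-suc : (p q : Subset n) (v : Fin n) →
    coefficient (inside ∷ p) (inside ∷ q) (suc v) ≈ - 1# * coefficient p q v
  coefficient-inside-suc p q v =
    term (does (v ∈? p) ∧ does (≡-dec Bool._≟_ (p - v) q)) (rank p v)
    where
    term : ∀ b r → (if b then (- 1#) ^ suc r else 0#) ≈ - 1# * (if b then (- 1#) ^ r else 0#)
    term true  r = ≈-refl
    term false r = ≈-sym (zeroʳ _)

  rank-zero : ∀ s (p : Subset n) → rank (s ∷ p) zero ≡ 0
  rank-zero s p rewrite Bool.∧-zeroʳ s = count-zero p
    where
    count-zero : ∀ {m} (p : Subset m) → ∣ p ∩ tabulate (λ u → does (suc u <? zero {m})) ∣ ≡ 0
    count-zero []      = refl
    count-zero (s ∷ p) rewrite Bool.∧-zeroʳ s = count-zero p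

  coefficient-zero : (p q : Subset n) →
    coefficient (inside ∷ p) (outside ∷ q) zero ≈ indicator q p
  coefficient-zero p q = reflexive
    (≡.cong₂ (λ r p′ → if does (≡-dec Bool._≟_ p′ q) then (- 1#) ^ r else 0#)
             (rank-zero inside p) (p─⊥≡p p))

  ∂-simplex-inside-inside : (σ : Face n (suc k)) (τ : Face n k) →
    ∂-simplex (addInside σ) (addInside τ) ≈ - ∂-simplex σ τ
  ∂-simplex-inside-inside σ τ = begin
    0# + sum (coefficient (inside ∷ p) (inside ∷ q) ∘ suc)   ≈⟨ +-identityˡ _ ⟩
    sum (coefficient (inside ∷ p) (inside ∷ q) ∘ suc)        ≈⟨ sum-cong-≋ (coefficient-inside-suc p q) ⟩
    sum (λ v → - 1# * coefficient p q v)                     ≈⟨ *-distribˡ-sum (- 1#) (coefficient p q) ⟨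
    - 1# * sum (coefficient p q)                             ≈⟨ -1*x≈-x _ ⟩
    - sum (coefficient p q)                                  ∎
    where
    p = vertices σ
    q = vertices τ

  ∂-simplex-outside-inside : (σ : Face n (suc (suc k))) (τ : Face n k) →
    ∂-simplex (addOutside σ) (addInside τ) ≈ 0#
  ∂-simplex-outside-inside σ τ = ≈-trans (+-identityˡ _) (sum-zero λ v →
    coefficient-∧-false (outside ∷ vertices σ) (inside ∷ vertices τ) (suc v) refl)

  ∂-simplex-outside-outside : (σ : Face n (suc k)) (τ : Face n k) →
    ∂-simplex (addOutside σ) (addOutside τ) ≈ ∂-simplex σ τ
  ∂-simplex-outside-outside σ τ = +-identityˡ _

  ∂-simplex-inside-outside : (σ τ : Face n k) →
    ∂-simplex (addInside σ) (addOutside τ) ≈ indicator (vertices τ) (vertices σ)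
  ∂-simplex-inside-outside σ τ = ≈-trans
    (+-cong (coefficient-zero (vertices σ) (vertices τ)) (sum-zero λ v →
       coefficient-∧-false (inside ∷ vertices σ) (outside ∷ vertices τ) (suc v) refl))
    (+-identityʳ _)

  -- The sum over `faces` splits by membership of the vertex 0. If `τ` contains 0, only simplices
  -- containing 0 contribute, with a sign; if not, those containing 0 contribute the single term of
  -- `τ` with 0 added, and the rest form the boundary on the later vertices.
  ∂ᶠ≈∂ : (Z : C n) (τ : Face n k) → ∂ᶠ (Z ∘ vertices) τ ≈ ∂ Z (vertices τ)
  ∂ᶠ≈∂ {zero}  {k}     Z (mkFace [] _)            = ≈-refl
  ∂ᶠ≈∂ {suc n} {zero}  Z (mkFace (inside ∷ p) e)  = ⊥-elim-irr (ℕ.1+n≢0 e)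
  ∂ᶠ≈∂ {suc n} {suc k} Z (mkFace (inside ∷ p) e)  = begin
    ∂ᶠ (Z ∘ vertices) (addInside τ)
      ≈⟨ ΣL-++-map _ addInside addOutside (faces n (suc k)) (faces n (suc (suc k))) ⟩
    ΣL (λ σ → Z (inside ∷ vertices σ) * ∂-simplex (addInside σ) (addInside τ)) (faces n (suc k)) +
    ΣL (λ σ → Z (outside ∷ vertices σ) * ∂-simplex (addOutside σ) (addInside τ)) (faces n (suc (suc k)))
      ≈⟨ +-elimʳ (ΣL-zero (λ σ → ≈-trans (*-congˡ (∂-simplex-outside-inside σ τ)) (zeroʳ _)) (faces n _)) ⟩
    ΣL (λ σ → Z (inside ∷ vertices σ) * ∂-simplex (addInside σ) (addInside τ)) (faces n (suc k))
      ≈⟨ ΣL-cong (λ σ → ≈-trans (*-congˡ (∂-simplex-inside-inside σ τ)) (≈-sym (-‿distribʳ-* _ _))) (faces n _) ⟩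
    ΣL (λ σ → - (Z (inside ∷ vertices σ) * ∂-simplex σ τ)) (faces n (suc k))
      ≈⟨ ΣL-neg _ (faces n (suc k)) ⟩
    - ∂ᶠ (Z ∘ (inside ∷_) ∘ vertices) τ
      ≈⟨ -‿cong (∂ᶠ≈∂ (Z ∘ (inside ∷_)) τ) ⟩
    - ∂ (Z ∘ (inside ∷_)) p ∎
    where
    τ : Face n k
    τ = mkFace p (ℕ.suc-injective e)
  ∂ᶠ≈∂ {suc n} {k}     Z (mkFace (outside ∷ p) e) = begin
    ∂ᶠ (Z ∘ vertices) (addOutside τ)
      ≈⟨ ΣL-++-map _ addInside addOutside (faces n k) (faces n (suc k)) ⟩
    ΣL (λ σ → Z (inside ∷ vertices σ) * ∂-simplex (addInside σ) (addOutside τ)) (faces n k) +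
    ΣL (λ σ → Z (outside ∷ vertices σ) * ∂-simplex (addOutside σ) (addOutside τ)) (faces n (suc k))
      ≈⟨ +-cong (ΣL-cong (λ σ → *-congˡ (∂-simplex-inside-outside σ τ)) (faces n k))
                (ΣL-cong (λ σ → *-congˡ (∂-simplex-outside-outside σ τ)) (faces n (suc k))) ⟩
    ΣL (λ σ → Z (inside ∷ vertices σ) * indicator p (vertices σ)) (faces n k) +
    ∂ᶠ (Z ∘ (outside ∷_) ∘ vertices) τ
      ≈⟨ +-cong (ΣL-indicator (Z ∘ (inside ∷_)) τ) (∂ᶠ≈∂ (Z ∘ (outside ∷_)) τ) ⟩
    Z (inside ∷ p) + ∂ (Z ∘ (outside ∷_)) p ∎
    where
    τ : Face n k
    τ = mkFace p e

-- The facets of a simplex through a fixed vertex have independent boundaries.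

module FacetIndependence {c ℓ} (F : Field c ℓ) {n m : ℕ} {τ : Subset n} (e : Enumeration τ (suc m)) where
  open ExteriorAlgebra F
  open BoundaryBridge F using (indicator; indicator-refl; indicator-≢)

  apex : Fin n
  apex = e .element zero

  facet : Fin m → Subset n
  facet i = τ [ e .element (suc i) ]≔ outside

  facets : (Fin m → Carrier) → C n
  facets λs = comb λs (indicator ∘ facet)

  facet-insert : ∀ i → facet i [ e .element (suc i) ]≔ inside ≡ τ
  facet-insert i = ≡.trans ([]≔-idempotent τ v)
    (≡.trans (≡.cong (τ [ v ]≔_) (≡.sym (e .sound (suc i)))) ([]≔-lookup τ v))
    where v = e .element (suc i)

  facet-outside : ∀ i → lookup (facet i) (e .element (suc i)) ≡ outside
  facet-outside i = lookup∘update (e .element (suc i)) τ outside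

  ∣facet∣ : ∀ i → suc ∣ facet i ∣ ≡ ∣ τ ∣
  ∣facet∣ i = ≡.trans (≡.sym (∣insert∣ (facet i) _ (facet-outside i))) (≡.cong ∣_∣ (facet-insert i))

  facet-inside : ∀ {i j} → j ≢ suc i → lookup (facet i) (e .element j) ≡ inside
  facet-inside {i} {j} j≢1+i =
    ≡.trans (lookup∘update′ (j≢1+i ∘ e .injective) τ outside) (e .sound j)

  facets-support : ∀ λs p → (∀ i → p ≢ facet i) → facets λs p ≈ 0#
  facets-support λs p p≢facet = comb-zero λs (indicator ∘ facet) {p} λ i → indicator-≢ (p≢facet i)

  facets-facet : ∀ λs i → facets λs (facet i) ≈ λs i
  facets-facet λs i = begin
    facets λs (facet i)
      ≈⟨ sum-remove′ i (λ j → λs j * indicator (facet j) (facet i)) others ⟩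
    λs i * indicator (facet i) (facet i)
      ≈⟨ *-congˡ (indicator-refl (facet i)) ⟩
    λs i * 1#
      ≈⟨ *-identityʳ (λs i) ⟩
    λs i ∎
    where
    sum-remove′ : ∀ {k} (i : Fin k) f → (∀ j → j ≢ i → f j ≈ 0#) → sum f ≈ f i
    sum-remove′ {suc k} i f f≈0 =
      ≈-trans (sum-remove {i = i} f) (+-elimʳ (sum-zero λ j → f≈0 _ (punchInᵢ≢i i j)))
    others : ∀ j → j ≢ i → λs j * indicator (facet j) (facet i) ≈ 0#
    others j j≢i = ≈-trans (*-congˡ (indicator-≢ {p = facet i} distinct)) (zeroʳ _)
      where
      distinct : facet i ≢ facet j
      distinct eq = contradiction
        (≡.trans (≡.sym (facet-inside {j} {suc i} λ { refl → j≢i refl }))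
          (≡.trans (≡.cong (λ p → lookup p (e .element (suc i))) (≡.sym eq)) (facet-outside i)))
        λ ()

  facets-avoids : ∀ λs {v} → lookup τ v ≡ outside → Avoids v (facets λs)
  facets-avoids λs {v} v∉τ p v∈p = facets-support λs p λ
    { i refl → contradiction (≡.trans (≡.sym v∈p) (v∉facet i)) λ () }
    where
    v∉facet : ∀ i → lookup (facet i) v ≡ outside
    v∉facet i with v ≟ e .element (suc i)
    ... | yes refl = facet-outside i
    ... | no v≢    = ≡.trans (lookup∘update′ v≢ τ outside) v∉τ

  -- All the facets used contain the apex, so coning over it inverts ∂ on their span.
  facets-independent : ∀ λs → ∂ (facets λs) ≋ 0ᶜ → ∀ i → λs i ≈ 0#
  facets-independent λs ∂w≈0 i = begin
    λs i                       ≈⟨ facets-facet λs i ⟨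
    w p                        ≈⟨ ∂ε+ε∂ apex w p ⟨
    ∂ (ε apex w) p + ε apex (∂ w) p
      ≈⟨ +-zero (zero-homo ∂-linear εw≈0 p) (zero-homo (ε-linear apex) ∂w≈0 p) ⟩
    0#                         ∎
    where
    w = facets λs
    p = facet i
    εw≈0 : ε apex w ≋ 0ᶜ
    εw≈0 q = ε-support apex w q (facets-support λs (q [ apex ]≔ outside) λ j eq → contradiction
      (≡.trans (≡.sym (facet-inside {j} {zero} λ ()))
        (≡.trans (≡.cong (λ r → lookup r apex) (≡.sym eq)) (lookup∘update apex q outside)))
      λ ())

-- Hypertrees as bases: fundamental cycles and spanning.

module Hypertree {c ℓ} (F : Field c ℓ) {n d : ℕ} (T : SimplexSet n d) (hypertree : IsHypertree F T) where
  open ExteriorAlgebra F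
  open BoundaryBridge F
  open Chains F using (Chain; SupportedOn; Acyclic) renaming (∂ to ∂ᶠ)
  open Chains.IsHypertree hypertree

  _∈ᵗ : Subset n → Set
  p ∈ᵗ = Σ (∣ p ∣ ≡ suc d) λ e → mkFace p e ∈ˢ T

  _∈ᵗ? : ∀ p → Dec (p ∈ᵗ)
  p ∈ᵗ? with ∣ p ∣ ℕ.≟ suc d
  ... | no ∣p∣≢  = no (∣p∣≢ ∘ proj₁)
  ... | yes ∣p∣≡ = map′ (∣p∣≡ ,_) proj₂ (T (mkFace p ∣p∣≡) Bool.≟ true)

  extend : ∀ {k} → Chain n k → C n
  extend {k} Z p with ∣ p ∣ ℕ.≟ k
  ... | yes e = Z (mkFace p e)
  ... | no _  = 0#

  extend-vertices : ∀ {k} (Z : Chain n k) p .(e : ∣ p ∣ ≡ k) → extend Z p ≡ Z (mkFace p e)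
  extend-vertices {k} Z p e with ∣ p ∣ ℕ.≟ k
  ... | yes _ = refl
  ... | no ¬e = contradiction-irr e ¬e

  extend-support : ∀ {k} (Z : Chain n k) p → (∀ (e : ∣ p ∣ ≡ k) → Z (mkFace p e) ≈ 0#) → extend Z p ≈ 0#
  extend-support {k} Z p h with ∣ p ∣ ℕ.≟ k
  ... | yes e = h e
  ... | no _  = ≈-refl

  ∂-extend : ∀ {k} (Z : Chain n (suc k)) (τ : Face n k) → ∂ (extend Z) (vertices τ) ≈ ∂ᶠ Z τ
  ∂-extend Z τ = ≈-trans (≈-sym (∂ᶠ≈∂ (extend Z) τ))
    (ΣL-cong (λ { (mkFace p e) → *-congʳ (reflexive (extend-vertices Z p e)) }) (faces n _))

  insertˢ : Face n (suc d) → SimplexSet n d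
  insertˢ σ τ = T τ ∨ does (≡-dec Bool._≟_ (vertices τ) (vertices σ))

  ¬∈insertˢ : ∀ {σ τ} → ¬ (τ ∈ˢ T) → vertices τ ≢ vertices σ → ¬ (τ ∈ˢ insertˢ σ)
  ¬∈insertˢ {σ} {τ} τ∉T τ≢σ τ∈ with T τ | ≡-dec Bool._≟_ (vertices τ) (vertices σ)
  ... | true  | _       = τ∉T refl
  ... | false | yes τ≡σ = τ≢σ τ≡σ
  ... | false | no _    = contradiction τ∈ λ ()

  -- By maximality, `T` with `p` added is not acyclic. A nonzero cycle on it cannot vanish at `p`,
  -- since it would then be supported on the acyclic `T`.
  fundamental-cycle : ∀ {p} → ∣ p ∣ ≡ suc d → ¬ (p ∈ᵗ) → ¬ ¬ ∃ λ (Z : C n) →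
    (∀ q → ∣ q ∣ ≡ d → ∂ Z q ≈ 0#) × (∀ q → ¬ (q ∈ᵗ) → q ≢ p → Z q ≈ 0#) × ¬ (Z p ≈ 0#)
  fundamental-cycle {p} ∣p∣≡ p∉T k = p∉T (∣p∣≡ , maximal (insertˢ σ) T⊆U U-acyclic σ σ∈U)
    where
    σ : Face n (suc d)
    σ = mkFace p ∣p∣≡
    T⊆U : T ⊆ˢ insertˢ σ
    T⊆U τ τ∈T rewrite τ∈T = refl
    σ∈U : σ ∈ˢ insertˢ σ
    σ∈U = ≡.trans (≡.cong (T σ ∨_) (dec-true (≡-dec Bool._≟_ p p) refl)) (Bool.∨-zeroʳ (T σ))
    U-acyclic : Acyclic (insertˢ σ)
    U-acyclic (Z , cycle , supp , Z≉0) = k (extend Z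
      , (λ q e → ≈-trans (∂-extend Z (mkFace q e)) (cycle (mkFace q e)))
      , outside-support
      , λ Zp≈0 → acyclic (Z , cycle , support-T (≈-trans (reflexive (≡.sym (extend-vertices Z p ∣p∣≡))) Zp≈0) , Z≉0))
      where
      outside-support : ∀ q → ¬ (q ∈ᵗ) → q ≢ p → extend Z q ≈ 0#
      outside-support q q∉T q≢p = extend-support Z q λ e →
        supp (mkFace q e) (¬∈insertˢ {σ} (λ q∈T → q∉T (e , q∈T)) q≢p)
      support-T : Z σ ≈ 0# → SupportedOn T Z
      support-T Zσ≈0 τ τ∉T with ≡-dec Bool._≟_ (vertices τ) p
      ... | yes refl = Zσ≈0
      ... | no τ≢σ   = supp τ (¬∈insertˢ {σ} τ∉T τ≢σ)

  -- At each listed simplex outside `T`, a multiple of its fundamental cycle cancels the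
  -- coefficient. That cycle vanishes at all other simplices outside `T`, so earlier cancellations
  -- persist.
  clear : (L : List (Subset n)) (Z : C n) → ¬ ¬ ∃ λ (Z′ : C n) →
    (∀ q → ∣ q ∣ ≡ d → ∂ Z′ q ≈ ∂ Z q) × All (λ p → ∣ p ∣ ≡ suc d → ¬ (p ∈ᵗ) → Z′ p ≈ 0#) L
  clear []      Z k = k (Z , (λ _ _ → ≈-refl) , [])
  clear (p ∷ L) Z k = clear L Z step
    where
    step : ¬ ∃ λ (Z′ : C n) →
      (∀ q → ∣ q ∣ ≡ d → ∂ Z′ q ≈ ∂ Z q) × All (λ p → ∣ p ∣ ≡ suc d → ¬ (p ∈ᵗ) → Z′ p ≈ 0#) L
    step (Z′ , ∂Z′≈∂Z , zeros) with p ∈ᵗ? | ∣ p ∣ ℕ.≟ suc d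
    ... | yes p∈T | _       = k (Z′ , ∂Z′≈∂Z , (λ _ p∉T → contradiction p∈T p∉T) ∷ zeros)
    ... | no _    | no ∣p∣≢ = k (Z′ , ∂Z′≈∂Z , (λ ∣p∣≡ _ → contradiction ∣p∣≡ ∣p∣≢) ∷ zeros)
    ... | no p∉T  | yes ∣p∣≡ = fundamental-cycle ∣p∣≡ p∉T λ where
      (Y , ∂Y≈0 , supp , Yp≉0) →
        let y⁻¹ , y⁻¹y≈1 , _ = invertible (Y p) Yp≉0
            a = - (Z′ p * y⁻¹)
            eliminated : a * Y p + Z′ p ≈ 0#
            eliminated = begin
              - (Z′ p * y⁻¹) * Y p + Z′ p      ≈⟨ +-congʳ (-‿distribˡ-* (Z′ p * y⁻¹) (Y p)) ⟨
              - (Z′ p * y⁻¹ * Y p) + Z′ p      ≈⟨ +-congʳ (-‿cong (*-assoc (Z′ p) y⁻¹ (Y p))) ⟩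
              - (Z′ p * (y⁻¹ * Y p)) + Z′ p    ≈⟨ +-congʳ (-‿cong (*-congˡ y⁻¹y≈1)) ⟩
              - (Z′ p * 1#) + Z′ p             ≈⟨ +-congʳ (-‿cong (*-identityʳ (Z′ p))) ⟩
              - Z′ p + Z′ p                    ≈⟨ -‿inverseˡ (Z′ p) ⟩
              0#                               ∎
            -- `L` may list `p` again, so `q = p` is a separate case.
            keep : ∀ {q} → (∣ q ∣ ≡ suc d → ¬ (q ∈ᵗ) → Z′ q ≈ 0#) →
                   ∣ q ∣ ≡ suc d → ¬ (q ∈ᵗ) → a * Y q + Z′ q ≈ 0#
            keep {q} = λ Z′q≈0 ∣q∣≡ q∉T → [ (λ { refl → eliminated })
              , (λ q≢p → +-zero (≈-trans (*-congˡ (supp q q∉T q≢p)) (zeroʳ a)) (Z′q≈0 ∣q∣≡ q∉T))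
              ]′ (toSum (≡-dec Bool._≟_ q p))
        in k (a · Y ⊕ Z′
             , (λ q ∣q∣≡ → ≈-trans (∂-linear .homo a Y Z′ q)
                 (≈-trans (+-elimˡ (≈-trans (*-congˡ (∂Y≈0 q ∣q∣≡)) (zeroʳ a))) (∂Z′≈∂Z q ∣q∣≡)))
             , (λ _ _ → eliminated) ∷ All.map keep zeros)

  spanning : (Z : C n) → ¬ ¬ ∃ λ (t : C n) →
    (∀ q → ∣ q ∣ ≡ d → ∂ t q ≈ ∂ Z q) × (∀ p → ¬ (p ∈ᵗ) → t p ≈ 0#)
  spanning Z k = clear (subsets n) Z λ where
      -- Restriction to `d`-simplices removes the values in other cardinalities, which `clear` does
      -- not control.
      (Z′ , ∂Z′≈∂Z , zeros) → k (extend (Z′ ∘ vertices)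
        , (λ q e → ≈-trans (∂-extend (Z′ ∘ vertices) (mkFace q e))
                     (≈-trans (∂ᶠ≈∂ Z′ (mkFace q e)) (∂Z′≈∂Z q e)))
        , λ p p∉T → extend-support (Z′ ∘ vertices) p λ ∣p∣≡ → All.lookup zeros (∈-subsets p) ∣p∣≡ p∉T)

  -- Each `x i` has a `T`-chain with the same boundary. Vanishing on `S` imposes fewer than `m`
  -- conditions on combinations of these chains, so `dependence` applies.
  spanning-avoiding : ∀ {m} (x : Fin m → C n) (S : List (Subset n)) → length S < m →
    ¬ ¬ ∃ λ λs → (∃ λ i → ¬ (λs i ≈ 0#)) × ∃ λ (t : C n) →
      (∀ q → ∣ q ∣ ≡ d → ∂ t q ≈ ∂ (comb λs x) q) × (∀ p → ¬ (p ∈ᵗ) → t p ≈ 0#) ×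
      (∀ {p} → p ∈ S → t p ≈ 0#)
  spanning-avoiding x S ∣S∣<m k = ¬¬-∀ (spanning ∘ x) λ ts →
    let t = proj₁ ∘ ts in
    dependence t S ∣S∣<m λ where
      (λs , nonzero , zeros) → k (λs , nonzero , comb λs t
        , (λ q e → begin
             ∂ (comb λs t) q        ≈⟨ linear-comb ∂-linear λs t q ⟩
             comb λs (∂ ∘ t) q      ≈⟨ sum-cong-≋ (λ i → *-congˡ {λs i} (proj₁ (proj₂ (ts i)) q e)) ⟩
             comb λs (∂ ∘ x) q      ≈⟨ linear-comb ∂-linear λs x q ⟨
             ∂ (comb λs x) q        ∎)
        , (λ p p∉T → comb-zero λs t λ i → proj₂ (proj₂ (ts i)) p p∉T)
        , All.lookup zeros)

  -- Deleting fewer than `d` simplices neither exhausts nor separates a hypertree.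

  -- Take the `d + 1` facets through one vertex of a set with `d + 2` elements. Some nonzero
  -- combination has the boundary of a `T`-chain vanishing on `S`. If `S` covered `T`, that chain
  -- would be zero, against the independence of the facets.
  nonempty : ∀ (S : List (Subset n)) → length S < d → suc (suc d) ≤ n → ¬ (∀ p → p ∈ᵗ → p ∈ S)
  nonempty S ∣S∣<d d+2≤n T⊆S with subset-of-size d+2≤n
  ... | τ , ∣τ∣≡ = spanning-avoiding (indicator ∘ facet) S (ℕ.m<n⇒m<1+n ∣S∣<d) λ where
     (λs , (i , λᵢ≉0) , t , ∂t≈∂w , t-supp , t-zero) →
      let t≋0 : t ≋ 0ᶜ
          t≋0 p = [ t-zero ∘ T⊆S p , t-supp p ]′ (toSum (p ∈ᵗ?))
          ∂w≋0 : ∂ (facets λs) ≋ 0ᶜ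
          ∂w≋0 q = [ (λ ∣q∣≡ → ≈-trans (≈-sym (∂t≈∂w q ∣q∣≡)) (zero-homo ∂-linear t≋0 q))
            , (λ ∣q∣≢ → ∂-support _ q λ v v∉q → facets-support λs (q [ v ]≔ inside) λ j eq →
                ∣q∣≢ (ℕ.suc-injective (≡.trans (≡.sym (∣insert∣ q v v∉q))
                  (ℕ.suc-injective (≡.trans (≡.cong (suc ∘ ∣_∣) eq) (≡.trans (∣facet∣ j) ∣τ∣≡))))))
            ]′ (toSum (∣ q ∣ ℕ.≟ d))
      in λᵢ≉0 (facets-independent λs ∂w≋0 i)
    where
    e : Enumeration τ (suc (suc d))
    e = ≡.subst (Enumeration τ) ∣τ∣≡ (enumerate τ)
    open FacetIndependence F e

  -- The core argument, with the two sides as predicates. Since the conclusion is `⊥`, the double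
  -- negation in `spanning-avoiding` is harmless.
  separation : (S : List (Subset n)) → length S < d → {A B : Subset n → Set} → (∀ p → Dec (A p)) →
    (∀ {p} → A p → ∣ p ∣ ≡ suc d) → (∀ {p} → B p → ∣ p ∣ ≡ suc d) →
    (∀ {p} → p ∈ᵗ → p ∈ S ⊎ A p ⊎ B p) →
    (∀ {σ τ} p → A σ → B τ → ∣ p ∣ ≡ d → p ⊑ σ → p ⊑ τ → ⊥) →
    ∀ {α β} → A α → B β → ⊥
  separation S ∣S∣<d {A} {B} A? ∣A∣ ∣B∣ cover separated {α} {β} Aα Bβ =
    -- The family consists of the prism chains of the `d` facets of `α` through its apex, against
    -- fewer than `d` conditions from `S`.
    spanning-avoiding (homotopy a b ∘ indicator ∘ facet) S ∣S∣<d contradictory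
    where
    open Matching (matching α β (≡.trans (∣A∣ Aα) (≡.sym (∣B∣ Bβ))))
    e : Enumeration α (suc d)
    e = ≡.subst (Enumeration α) (∣A∣ Aα) (enumerate α)
    open FacetIndependence F e

    a b : Fin size → Fin n
    a = from .element
    b = to .element

    a∈α : ∀ i → lookup α (a i) ≡ inside
    a∈α i = proj₁ (∈-∩∁⁻ α β (a i) (from .sound i))
    b∈β : ∀ i → lookup β (b i) ≡ inside
    b∈β i = proj₁ (∈-∩∁⁻ β α (b i) (to .sound i))
    b∉α : ∀ i → lookup α (b i) ≡ outside
    b∉α i = proj₂ (∈-∩∁⁻ β α (b i) (to .sound i))

    a≢b : ∀ i j → a i ≢ b j
    a≢b i j a≡b = contradiction
      (≡.trans (≡.sym (a∈α i)) (≡.trans (≡.cong (lookup α) a≡b) (b∉α j))) λ ()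

    -- The exchanged chain lives on `β`: a vertex outside `β` is either some `a i`, which has been
    -- removed, or outside `α` and never a target.
    moved-avoids : ∀ λs {v} → lookup β v ≡ outside → Avoids v (replaceAll a b (facets λs))
    moved-avoids λs {v} v∉β with lookup α v in eq
    ... | false = replaceAll-avoids a b
      (λ { j refl → contradiction (≡.trans (≡.sym v∉β) (b∈β j)) λ () }) (facets-avoids λs eq)
    ... | true with from .complete v (∈-∩∁⁺ α β v eq v∉β)
    ...   | i , refl = replaceAll-sources a b (facets λs) a≢b i

    contradictory : ¬ ∃ λ λs → (∃ λ i → ¬ (λs i ≈ 0#)) × ∃ λ (t : C n) →
      (∀ q → ∣ q ∣ ≡ d → ∂ t q ≈ ∂ (comb λs (homotopy a b ∘ indicator ∘ facet)) q) ×
      (∀ p → ¬ (p ∈ᵗ) → t p ≈ 0#) × (∀ {p} → p ∈ S → t p ≈ 0#)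
    contradictory (λs , (i , λᵢ≉0) , t , ∂t≈ , t-supp , t-zero) =
      λᵢ≉0 (facets-independent λs ∂w≋0 i)
      where
      w tᴬ tᴮ : C n
      w = facets λs
      tᴬ p = if does (A? p) then t p else 0#
      tᴮ p = if does (A? p) then 0# else t p

      t≋ : t ≋ tᴬ ⊕ tᴮ
      t≋ p with does (A? p)
      ... | true  = ≈-sym (+-identityʳ _)
      ... | false = ≈-sym (+-identityˡ _)

      tᴬ-supp : ∀ {p} → ¬ A p → tᴬ p ≈ 0#
      tᴬ-supp {p} p∉A with A? p
      ... | yes p∈A = contradiction p∈A p∉A
      ... | no _    = ≈-refl

      tᴮ-supp : ∀ {p} → ¬ B p → tᴮ p ≈ 0#
      tᴮ-supp {p} p∉B with A? p
      ... | yes _  = ≈-refl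
      ... | no p∉A with p ∈ᵗ?
      ...   | no p∉T = t-supp p p∉T
      ...   | yes p∈T with cover p∈T
      ...     | inj₁ p∈S        = t-zero p∈S
      ...     | inj₂ (inj₁ p∈A) = contradiction p∈A p∉A
      ...     | inj₂ (inj₂ p∈B) = contradiction p∈B p∉B

      ∂t≈∂homotopy : ∀ q → ∣ q ∣ ≡ d → ∂ t q ≈ ∂ (homotopy a b w) q
      ∂t≈∂homotopy q ∣q∣≡ = ≈-trans (∂t≈ q ∣q∣≡)
        (≈-sym (∂-linear .cong (linear-comb (homotopy-linear a b) λs (indicator ∘ facet)) q))

      -- If `p` has no coface in `A`, both terms vanish, since every facet in `w` has the coface
      -- `α`. Otherwise `p` has no coface in `B`, so `∂ tᴬ` agrees with `∂ t` at `p` and the sum is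
      -- the exchanged chain. That chain vanishes at `p`, because `p` inside `β` would be a face
      -- shared by `A` and `B`.
      transversal-zero : ∀ p → Transversal a b p → (∂ tᴬ ⊕ w) p ≈ 0#
      transversal-zero p tr
        with any? (λ v → (lookup p v Bool.≟ outside) ×-dec A? (p [ v ]≔ inside))
      ... | no none = +-zero
        (∂-support tᴬ p λ v v∉p → tᴬ-supp λ p+v∈A → none (v , v∉p , p+v∈A))
        (facets-support λs p λ { j refl →
          none (e .element (suc j) , facet-outside j , ≡.subst A (≡.sym (facet-insert j)) Aα) })
      ... | yes (v , v∉p , p+v∈A) = begin
        ∂ tᴬ p + w p                      ≈⟨ +-comm _ _ ⟩
        w p + ∂ tᴬ p                      ≈⟨ +-congˡ (+-elimʳ ∂tᴮp≈0) ⟨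
        w p + (∂ tᴬ p + ∂ tᴮ p)           ≈⟨ +-congˡ (⊕-homo ∂-linear tᴬ tᴮ p) ⟨
        w p + ∂ (tᴬ ⊕ tᴮ) p               ≈⟨ +-congˡ (∂-linear .cong t≋ p) ⟨
        w p + ∂ t p                       ≈⟨ +-congˡ (∂t≈∂homotopy p ∣p∣≡d) ⟩
        w p + ∂ (homotopy a b w) p        ≈⟨ ∂-homotopy a b w p a≢b tr ⟩
        replaceAll a b w p                ≈⟨ moved-zero ⟩
        0#                                ∎
        where
        ∣p∣≡d : ∣ p ∣ ≡ d
        ∣p∣≡d = ℕ.suc-injective (≡.trans (≡.sym (∣insert∣ p v v∉p)) (∣A∣ p+v∈A))
        ∂tᴮp≈0 : ∂ tᴮ p ≈ 0#
        ∂tᴮp≈0 = ∂-support tᴮ p λ u u∉p → tᴮ-supp λ p+u∈B →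
          separated p p+v∈A p+u∈B ∣p∣≡d (⊑-insert v p) (⊑-insert u p)
        moved-zero : replaceAll a b w p ≈ 0#
        moved-zero with any? (λ u → (lookup p u Bool.≟ inside) ×-dec (lookup β u Bool.≟ outside))
        ... | yes (u , u∈p , u∉β) = moved-avoids λs u∉β p u∈p
        ... | no none = contradiction
          (λ u u∈p → Bool.¬-not λ u∉β → none (u , u∈p , u∉β))
          (separated p p+v∈A Bβ ∣p∣≡d (⊑-insert v p))

      ∂w≋0 : ∂ w ≋ 0ᶜ
      ∂w≋0 p = begin
        ∂ w p
          ≈⟨ ∂-linear .cong (replaceAll-fixes b a (λ j → facets-avoids λs (b∉α j))) p ⟨
        ∂ (replaceAll b a w) p
          ≈⟨ ∂-replaceAll b a w p ⟩
        replaceAll b a (∂ w) p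
          -- Adding `∂ (∂ tᴬ)`, which is zero, exposes the boundary of the degenerate chain
          -- `∂ tᴬ ⊕ w`.
          ≈⟨ replaceAll-linear b a .cong (λ q → +-elimˡ (∂∂≋0 tᴬ q)) p ⟨
        replaceAll b a (∂ (∂ tᴬ) ⊕ ∂ w) p
          ≈⟨ replaceAll-linear b a .cong (⊕-homo ∂-linear (∂ tᴬ) w) p ⟨
        replaceAll b a (∂ (∂ tᴬ ⊕ w)) p
          ≈⟨ ∂-replaceAll b a (∂ tᴬ ⊕ w) p ⟨
        ∂ (replaceAll b a (∂ tᴬ ⊕ w)) p
          ≈⟨ zero-homo ∂-linear
               (replaceAll-kills a b _ (from .injective) (to .injective) a≢b transversal-zero) p ⟩
        0# ∎

-- Connectivity of the facet graph after deletion.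

⊑⇒⊆ : {p q : Subset n} → p ⊑ q → p ⊆ q
⊑⇒⊆ {p = p} {q} p⊑q {v} v∈p = lookup⇒[]= v q (p⊑q v ([]=⇒lookup v∈p))

module FacetGraph {c ℓ} (F : Field c ℓ) {n d : ℕ} (T : SimplexSet n d) (hypertree : IsHypertree F T)
                  (S : List (Graph.Vertex (facetGraph T))) where
  open Hypertree F T hypertree

  G : Graph
  G = delete (facetGraph T) S

  removed : List (Subset n)
  removed = map (vertices ∘ value) S

  _∈removed? : ∀ p → Dec (p ∈ removed)
  p ∈removed? = DecMembership._∈?_ (≡-dec Bool._≟_) p removed

  Alive : Subset n → Set
  Alive p = p ∈ᵗ × p ∉ removed

  alive? : ∀ p → Dec (Alive p)
  alive? p = (p ∈ᵗ?) ×-dec ¬? (p ∈removed?)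

  toVertex : ∀ {p} → Alive p → Graph.Vertex G
  toVertex {p} ((∣p∣≡ , p∈T) , p∉S) =
    (mkFace p ∣p∣≡ , [ p∈T ]) , [ (λ σ∈S → p∉S (∈-map⁺ (vertices ∘ value) σ∈S)) ]

  -- The proofs stored in a vertex are irrelevant; decidability recovers usable ones, and the
  -- non-membership proof is only used to reach absurdity.
  fromVertex : (u : Graph.Vertex G) → Alive (vertices (value (value u)))
  fromVertex ((mkFace p ∣p∣≡ , [ p∈T ]) , [ u∉S ]) =
    ( recompute (∣ p ∣ ℕ.≟ suc d) ∣p∣≡
    , recompute (T (mkFace p ∣p∣≡) Bool.≟ true) p∈T )
    , λ p∈S → p∉S (∈-map⁻ (vertices ∘ value) p∈S)
    where
    p∉S : ¬ ∃ λ σ → σ ∈ S × p ≡ vertices (value σ)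
    p∉S (_ , u∈S , refl) = ⊥-elim-irr (u∉S u∈S)

  -- Adjacency moved to bare subsets, which `subsets` lists. Both ends are required alive so that
  -- paths lift back to `G`.
  Edge : Subset n → Subset n → Set
  Edge σ τ = Alive σ × Alive τ × σ ≢ τ × ∃ λ p → ∣ p ∣ ≡ d × p ⊆ σ × p ⊆ τ

  edge? : Decidable Edge
  edge? σ τ = alive? σ ×-dec alive? τ ×-dec ¬? (≡-dec Bool._≟_ σ τ) ×-dec
    anySubset? λ p → (∣ p ∣ ℕ.≟ d) ×-dec (p ⊆? σ) ×-dec (p ⊆? τ)

  open Reachability (≡-dec Bool._≟_) edge?

  liftPath : ∀ {σ τ} (aσ : Alive σ) (aτ : Alive τ) → Star Edge σ τ →
             Star (Graph.Adj G) (toVertex aσ) (toVertex aτ)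
  liftPath aσ aτ Star.ε = Star.ε
  liftPath aσ aτ ((_ , aρ , σ≢ρ , p , ∣p∣≡ , p⊆σ , p⊆ρ) Star.◅ path) =
    ((λ eq → σ≢ρ (≡.cong vertices eq)) , mkFace p ∣p∣≡ , p⊆σ , p⊆ρ) Star.◅ liftPath aρ aτ path

  module _ (∣S∣<d : length S < d) where

    ∣removed∣<d : length removed < d
    ∣removed∣<d = ≡.subst (_< d) (≡.sym (length-map (vertices ∘ value) S)) ∣S∣<d

    -- Reachability is decidable, so it suffices to refute its failure. The sides are the survivors
    -- reachable from `σ` and those that are not; a shared face would extend a path across.
    connected : ∀ {σ τ} → Alive σ → Alive τ → Star Edge σ τ
    connected {σ} {τ} aσ aτ with path? (subsets n) σ τ
    ... | yes path = path⇒star (subsets n) path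
    ... | no ¬path = ⊥-elim (
      separation removed ∣removed∣<d {A} {B} (λ ρ → alive? ρ ×-dec path? (subsets n) σ ρ)
        (proj₁ ∘ proj₁ ∘ proj₁) (proj₁ ∘ proj₁ ∘ proj₁) cover separated
        (aσ , path-refl (subsets n)) (aτ , ¬path))
      where
      A B : Subset n → Set
      A ρ = Alive ρ × Path (subsets n) σ ρ
      B ρ = Alive ρ × ¬ Path (subsets n) σ ρ
      cover : ∀ {p} → p ∈ᵗ → p ∈ removed ⊎ A p ⊎ B p
      cover {p} p∈T with p ∈removed? | path? (subsets n) σ p
      ... | yes p∈S | _        = inj₁ p∈S
      ... | no p∉S  | yes path = inj₂ (inj₁ ((p∈T , p∉S) , path))
      ... | no p∉S  | no ¬path = inj₂ (inj₂ ((p∈T , p∉S) , ¬path))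
      separated : ∀ {ρ ρ′} p → A ρ → B ρ′ → ∣ p ∣ ≡ d → p ⊑ ρ → p ⊑ ρ′ → ⊥
      separated {ρ} p (aρ , path) (aρ′ , ¬path) ∣p∣≡ p⊑ρ p⊑ρ′ = ¬path
        (path-trans (∈-subsets ρ) path (path-edge (subsets n)
          (aρ , aρ′ , (λ { refl → ¬path path }) , p , ∣p∣≡ , ⊑⇒⊆ p⊑ρ , ⊑⇒⊆ p⊑ρ′)))

    survivor : suc (suc d) ≤ n → ∃ Alive
    survivor d+2≤n with anySubset? alive?
    ... | yes alive = alive
    ... | no none   = contradiction
      (λ p p∈T → decidable-stable (p ∈removed?) λ p∉S → none (p , p∈T , p∉S))
      (nonempty removed ∣removed∣<d d+2≤n)

open import Data.Nat.Base using (_+_)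

theorem4p4 : ∀ {c ℓ} (F : Field c ℓ) (d n : ℕ) → 1 ≤ d → d + 2 ≤ n →
    (T : SimplexSet n d) → IsHypertree F T → KConnected d (facetGraph T)
theorem4p4 F d n _ d+2≤n T hypertree S _ ∣S∣<d =
  toVertex (proj₂ (survivor ∣S∣<d (≡.subst (_≤ n) (ℕ.+-comm d 2) d+2≤n))) ,
  -- By eta and proof irrelevance, `toVertex (fromVertex u)` is `u` itself.
  λ u v → liftPath (fromVertex u) (fromVertex v) (connected ∣S∣<d (fromVertex u) (fromVertex v))
  where open FacetGraph F T hypertree S
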